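{- Let $\kappa$ be a regular uncountable cardinal, let $U\subseteq{}^{<\kappa}\kappa$ be a slim downward-closed $\kappa$-tree, and suppose $\mathrm{P}_{14}(\kappa,\sqsubseteq,1,\{\kappa\})$ holds. Then there exists a downward-closed $T\subseteq{}^{<\kappa}\kappa$ which is a prolific slim $\kappa$-Souslin tree admitting an injective $(\mathcal F^{\mathrm{fin}}_{\aleph_0},U)$-ascent path.
   Context: Downward-closed subsets of ${}^{<\kappa}\kappa$ are ordered by $\subsetneq$; height is $\mathrm{dom}$; $T_\alpha=T\cap{}^\alpha\kappa$. Prolific: $x^\frown\langle i\rangle\in T$ for all $x\in T_\alpha$, $\alpha<\kappa$, $i<\max\{\omega,\alpha\}$. Slim: $|T_\alpha|\le\max\{|\alpha|,\aleph_0\}$. $\kappa$-tree: height $\kappa$, levels of size $<\kappa$; $\kappa$-Souslin: $\kappa$-tree with no cofinal branch and no antichain of size $\kappa$. $\mathcal F^{\mathrm{fin}}_{\aleph_0}=\{Z\subseteq\omega\mid\omega\setminus Z$ finite$\}$. An $(\mathcal F,U)$-ascent path through $T$ is $\langle f_u\mid u\in U\rangle$ with $f_u:\bigcup\mathcal F\to T_{\mathrm{dom}(u)}$, $\{i\mid f_u(i)\subsetneq f_v(i)\}\in\mathcal F$ for $u\subsetneq v$ in $U$, and $\{i\mid f_u(i)\ne f_v(i)\}\in\mathcal F$ for distinct $u,v\in U$ of the same domain; it is injective if for every $b:\kappa\to\kappa$ with $\{b\restriction\alpha\mid\alpha<\kappa\}\subseteq U$ there are $\alpha<\kappa$ and $I\in\mathcal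 F$ with $f_{b\restriction\alpha}\restriction I$ injective. $\mathrm{P}_{14}(\kappa,\sqsubseteq,1,\{\kappa\})$: $\diamondsuit(\kappa)$ holds and there is $\langle C_\alpha\mid\alpha<\kappa\rangle$ with $C_\alpha$ club in $\alpha$ for limit $\alpha$, $C_{\bar\alpha}=C_\alpha\cap\bar\alpha$ whenever $\bar\alpha\in\mathrm{acc}(C_\alpha)=\{\gamma\in C_\alpha\mid\sup(C_\alpha\cap\gamma)=\gamma>0\}$, and for every cofinal $A\subseteq\kappa$ there are stationarily many $\alpha<\kappa$ with $\sup\{\beta\in C_\alpha\mid\mathrm{succ}_\omega(C_\alpha\setminus\beta)\subseteq A\}=\alpha$, where $\mathrm{succ}_\omega(D)=\{\delta\in D\mid0<\mathrm{otp}(D\cap\delta)<\omega\}$. -}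

-- Types and functions play the role of sets, and cardinalities are compared by
-- injections and bijections with respect to _≡_.  Nothing here is classical by
-- itself; the intended ambient theory is obtained by assuming function
-- extensionality and excluded middle for all types.  As `Dec P` contains an
-- element of P whenever P is inhabited, these also supply the axiom of choice.

module Defs where

open import Data.Fin.Base as Fin using (Fin)
open import Data.Irrelevant as Irrelevant using ([_])
open import Data.List.Base using (List)
open import Data.List.Membership.Propositional using () renaming (_∈_ to _∈ₗ_)
open import Data.Nat.Base using (ℕ) renaming (suc to 1+)
open import Data.Product.Base using (Σ; Σ-syntax; ∃-syntax; _×_; _,_; proj₁; proj₂)
open import Data.Refinement using (Refinement-syntax; value)
open import Data.Sum.Base using (_⊎_)
open import Function.Base using (_∘_)
open import Function.Bundles using (_↣_; _↔_)
open import Induction.WellFounded using (WellFounded)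
open import Level using (Level; _⊔_; suc)
open import Relation.Binary.Core using (Rel; _Preserves_⟶_)
open import Relation.Binary.PropositionalEquality.Core using (_≡_; _≢_)
open import Relation.Binary.Structures using (IsStrictTotalOrder)
open import Relation.Nullary.Negation.Core using (¬_)
open import Relation.Unary using (Pred; _∈_; _⊆_; _≐_; _∩_; _∖_; _≬_; ∁; U)

infix 4 _≼_ _≺_

_≼_ : ∀ {a b} → Set a → Set b → Set (a ⊔ b)
A ≼ B = A ↣ B

_≺_ : ∀ {a b} → Set a → Set b → Set (a ⊔ b)
A ≺ B = A ≼ B × ¬ (B ≼ A)

-- An ordinal is represented by a well-ordered type and its elements are the
-- smaller ordinals; `Below α` is α regarded as a set of ordinals.

record RegularUncountableCardinal (ℓ : Level) : Set (suc ℓ) where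
  infix 4 _<_ _≤_
  field
    Ord                : Set ℓ
    _<_                : Rel Ord ℓ
    isStrictTotalOrder : IsStrictTotalOrder _≡_ _<_
    wellFounded        : WellFounded _<_

  _≤_ : Rel Ord ℓ
  α ≤ β = α < β ⊎ α ≡ β

  Below : Ord → Set ℓ
  Below α = [ β ∈ Ord ∣ β < α ]

  field
    isCardinal    : ∀ α → Below α ≺ Ord
    isRegular     : ∀ α (g : Below α → Ord) → ∃[ β ] ∀ ξ → g ξ < β
    isUncountable : ¬ (Ord ≼ ℕ)

  open IsStrictTotalOrder isStrictTotalOrder public using () renaming (trans to <-trans)

module _ {ℓ : Level} (κ : RegularUncountableCardinal ℓ) where
  open RegularUncountableCardinal κ

  IsZero : Pred Ord ℓ
  IsZero α = ∀ β → ¬ (β < α)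

  IsSuccessor : Ord → Ord → Set ℓ
  IsSuccessor α α⁺ = α < α⁺ × (∀ β → α < β → α⁺ ≤ β)

  IsLimit : Pred Ord ℓ
  IsLimit α = ¬ IsZero α × (∀ β → ¬ IsSuccessor β α)

  -- P has order type the natural number n.
  HasOtp : Pred Ord ℓ → ℕ → Set ℓ
  HasOtp P n = Σ[ e ∈ (Fin n → Ord) ]
    (e Preserves Fin._<_ ⟶ _<_) × P ≐ (λ β → ∃[ i ] e i ≡ β)

  -- The natural numbers among the ordinals below κ.
  Below-ω : Pred Ord ℓ
  Below-ω α = ∃[ n ] HasOtp (_< α) n

  IsSup : Pred Ord ℓ → Ord → Set ℓ
  IsSup P γ = P ⊆ (_≤ γ) × (∀ δ → P ⊆ (_≤ δ) → γ ≤ δ)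

  -- In the next two definitions B is an ordinal ≤ κ regarded as a set of
  -- ordinals: either `_< α`, or `U` for κ itself.

  IsCofinalIn : ∀ {b} → Pred Ord b → Pred Ord ℓ → Set (ℓ ⊔ b)
  IsCofinalIn B A = A ⊆ B × (∀ β → β ∈ B → ∃[ γ ] γ ∈ A × β ≤ γ)

  IsClubIn : ∀ {b} → Pred Ord b → Pred Ord ℓ → Set (ℓ ⊔ b)
  IsClubIn B C = IsCofinalIn B C ×
    (∀ γ → γ ∈ B → ¬ IsZero γ → IsSup (C ∩ (_< γ)) γ → γ ∈ C)

  IsStationary : Pred Ord ℓ → Set (suc ℓ)
  IsStationary S = ∀ (C : Pred Ord ℓ) → IsClubIn U C → S ≬ C

  acc : Pred Ord ℓ → Pred Ord ℓ
  acc C γ = γ ∈ C × IsSup (C ∩ (_< γ)) γ × ¬ IsZero γ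

  succ-ω : Pred Ord ℓ → Pred Ord ℓ
  succ-ω D δ = δ ∈ D × (∃[ n ] HasOtp (D ∩ (_< δ)) (1+ n))

  Diamond : Set (suc ℓ)
  Diamond = Σ[ S ∈ (Ord → Pred Ord ℓ) ]
    (∀ α → S α ⊆ (_< α)) ×
    (∀ (A : Pred Ord ℓ) → IsStationary (λ α → (A ∩ (_< α)) ≐ S α))

  record IsProxySequence (C : Ord → Pred Ord ℓ) : Set (suc ℓ) where
    field
      club     : ∀ α → IsLimit α → IsClubIn (_< α) (C α)
      coherent : ∀ α ᾱ → ᾱ ∈ acc (C α) → C ᾱ ≐ (C α ∩ (_< ᾱ))
      hitting  : ∀ (A : Pred Ord ℓ) → IsCofinalIn U A →
        IsStationary λ α →
          IsSup (λ β → β ∈ C α × succ-ω (C α ∖ (_< β)) ⊆ A) α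

  -- P₁₄(κ,⊑,1,{κ})
  P₁₄ : Set (suc ℓ)
  P₁₄ = Diamond × (Σ[ C ∈ (Ord → Pred Ord ℓ) ] IsProxySequence C)

  Seq : Set ℓ
  Seq = Σ[ α ∈ Ord ] (Below α → Ord)

  dom : Seq → Ord
  dom = proj₁

  shorten : (x : Seq) {α : Ord} → α < dom x → Seq
  shorten (_ , x) {α} α<dom =
    α , λ { (β Data.Refinement., β<α) →
            x (β Data.Refinement., Irrelevant.map (λ p → <-trans p α<dom) β<α) }

  -- Proper inclusion of sequences regarded as sets of pairs.
  infix 4 _⊊_
  _⊊_ : Rel Seq ℓ
  x ⊊ y = Σ[ p ∈ dom x < dom y ] x ≡ shorten y p

  -- y is x⌢⟨i⟩
  IsSnoc : Seq → Ord → Seq → Set ℓ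
  IsSnoc x i y = IsSuccessor (dom x) (dom y) × x ⊊ y ×
    (∀ (p : dom x < dom y) → proj₂ y (dom x Data.Refinement., [ p ]) ≡ i)

  infix 5 _↾_
  _↾_ : (Ord → Ord) → Ord → Seq
  b ↾ α = α , b ∘ value

  -- Membership proofs are irrelevant, so that `≼` counts sequences only.
  Lev : Pred Seq ℓ → Ord → Set ℓ
  Lev T α = [ x ∈ (Below α → Ord) ∣ T (α , x) ]

  IsDownwardClosed : Pred Seq ℓ → Set ℓ
  IsDownwardClosed T = ∀ x y → x ⊊ y → y ∈ T → x ∈ T

  -- Being below (or at most) a maximum is rendered as a disjunction, here and in
  -- `IsSlim`; dom x + 1 and x⌢⟨i⟩ always exist because κ is a limit ordinal.
  IsProlific : Pred Seq ℓ → Set ℓ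
  IsProlific T = ∀ x → x ∈ T → ∀ i → Below-ω i ⊎ i < dom x →
    ∀ y → IsSnoc x i y → y ∈ T

  IsSlim : Pred Seq ℓ → Set ℓ
  IsSlim T = ∀ α → (Lev T α ≼ Below α) ⊎ (Lev T α ≼ ℕ)

  -- Height κ means that every level is nonempty.
  IsκTree : Pred Seq ℓ → Set ℓ
  IsκTree T = (∀ α → Lev T α) × (∀ α → Lev T α ≺ Ord)

  IsChain : Pred Seq ℓ → Set ℓ
  IsChain B = ∀ x y → x ∈ B → y ∈ B → x ⊊ y ⊎ x ≡ y ⊎ y ⊊ x

  IsAntichain : Pred Seq ℓ → Set ℓ
  IsAntichain A = ∀ x y → x ∈ A → y ∈ A → ¬ (x ⊊ y)

  IsCofinalBranch : Pred Seq ℓ → Pred Seq ℓ → Set ℓ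
  IsCofinalBranch T B = B ⊆ T × IsChain B × (∀ α → ∃[ x ] x ∈ B × dom x ≡ α)

  record IsSouslin (T : Pred Seq ℓ) : Set (suc ℓ) where
    field
      isκTree         : IsκTree T
      noCofinalBranch : ∀ (B : Pred Seq ℓ) → ¬ IsCofinalBranch T B
      noBigAntichain  : ∀ (A : Pred Seq ℓ) → A ⊆ T → IsAntichain A →
                        ¬ ([ x ∈ Seq ∣ A x ] ↔ Ord)

  -- The family 𝓕 consists of subsets of a type I, which is
  -- required to be ⋃𝓕 for the definitions to have their usual meaning.

  module _ {i : Level} {I : Set i} (𝓕 : Pred (Pred I ℓ) ℓ) (V T : Pred Seq ℓ) where

    PathFamily : Set (ℓ ⊔ i)
    PathFamily = (u : [ x ∈ Seq ∣ V x ]) → I → Lev T (dom (value u))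

    node : PathFamily → [ x ∈ Seq ∣ V x ] → I → Seq
    node f u i = dom (value u) , value (f u i)

    record IsAscentPath (f : PathFamily) : Set (ℓ ⊔ i) where
      field
        ascending : ∀ u v → value u ⊊ value v →
                    (λ i → node f u i ⊊ node f v i) ∈ 𝓕
        separated : ∀ u v → value u ≢ value v → dom (value u) ≡ dom (value v) →
                    (λ i → node f u i ≢ node f v i) ∈ 𝓕

    IsInjectivePath : PathFamily → Set (suc ℓ ⊔ i)
    IsInjectivePath f = ∀ (b : Ord → Ord) (b∈V : ∀ α → (b ↾ α) ∈ V) →
      ∃[ α ] Σ[ Z ∈ Pred I ℓ ] Z ∈ 𝓕 ×
        (∀ i j → i ∈ Z → j ∈ Z →
          let u = (b ↾ α) Data.Refinement., [ b∈V α ] in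
          f u i ≡ f u j → i ≡ j)

    HasInjectiveAscentPath : Set (suc ℓ ⊔ i)
    HasInjectiveAscentPath = Σ[ f ∈ PathFamily ] IsAscentPath f × IsInjectivePath f

-- The family of cofinite subsets of ω; its union is all of ℕ.
𝓕fin : ∀ {ℓ} → Pred (Pred ℕ ℓ) ℓ
𝓕fin Z = Σ[ xs ∈ List ℕ ] ∁ Z ⊆ (_∈ₗ xs)

{-# OPTIONS --safe #-}
-- The levels T_α and the maps f_u (u ∈ U_α) are built by recursion on α.  At
-- α + 1 every node gets as successors all values below max(α + 1, ω), and f_u(i)
-- is prolonged by a code of the pair (u, i); hence distinct u, and distinct i,
-- are told apart at successor levels.  At a limit α the nodes are the limits of
-- climbs along C_α, one for each x ∈ T_δ (δ ∈ C_α), u ∈ U_α and i < ω: to pass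
-- from γ to the next point β of C_α, a climb follows f_{u↾β}(i) if that extends
-- the node reached at γ and β has at most i consecutive predecessors in C_α;
-- otherwise it moves to a node of T_β that extends, whenever possible, an element
-- of the set guessed by ◇ at β.  The map f_u collects the climbs that start from
-- the f_{u↾δ}(i) with δ = min C_α.  Coherence of C makes the climbs meet T_β at
-- the accumulation points β, where the climbs of f_u even agree with f_{u↾β}.  At
-- the other points almost all i follow f_{u↾β}, so f_u is an ascent path, while
-- on a block of ω successive points each single climb leaves f for all but
-- finitely many of them.  As such blocks of correctly guessing points exist, for
-- every dense upward closed D ⊆ T some level T_α is contained in D.  Applied to
-- the nodes deciding a given antichain, or avoiding a given branch, this shows
-- that T is Souslin.  Slimness rests on μ · μ = μ for infinite ordinals μ.

module Submission where

open import Defs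
open import Axiom.ExcludedMiddle using (ExcludedMiddle)
open import Axiom.Extensionality.Propositional using (Extensionality)
open import Data.Empty using (⊥)
open import Data.Fin.Base as Fin using (Fin; toℕ)
open import Data.Fin.Properties using (toℕ<n; toℕ-fromℕ; toℕ-inject₁; pigeonhole)
open import Data.Irrelevant using ([_])
open import Data.List.Base using (upTo)
open import Data.List.Membership.Propositional.Properties using (∈-upTo⁺)
open import Data.Nat.Base as ℕ using (ℕ; zero) renaming (suc to 1+)
import Data.Nat.Properties as ℕₚ
open import Data.Product.Base using (Σ; Σ-syntax; ∃; ∃₂; _×_; _,_; proj₁; proj₂)
open import Data.Product.Relation.Binary.Lex.Strict using (×-Lex; ×-wellFounded)
import Data.Refinement as Refinement
open Refinement using (value; value-injective)
open import Data.Sum.Base using (_⊎_; inj₁; inj₂)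
open import Data.Unit.Polymorphic.Base using (⊤; tt)
open import Function.Base using (_∘_; _on_; case_of_; id)
open import Function.Bundles using (mk↣; _↔_; Injection; Inverse)
open import Induction.WellFounded using (WellFounded; module All; module FixPoint)
open import Level using (Level; _⊔_)
open import Relation.Binary.Core using (Rel)
import Relation.Binary.Construct.On as On
open import Relation.Binary.Definitions using (tri<; tri≈; tri>)
open import Relation.Binary.PropositionalEquality
  using (_≡_; _≢_; refl; sym; trans; cong; cong₂; cong-app; subst; module ≡-Reasoning)
open import Relation.Binary.Structures using (IsStrictTotalOrder)
open import Relation.Nullary.Decidable.Core using (yes; no; recompute)
open import Relation.Nullary.Negation.Core using (¬_; contradiction)
open import Relation.Unary using (Pred; _∈_; _⊆_; _≐_; _∩_; _∖_; U)

private
  variable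
    a p r : Level
    A : Set a

-- Definition by cases, choice and well-founded recursion

module Classical (em : ∀ {a} → ExcludedMiddle a) where

  opaque
    ite : Set p → A → A → A
    ite P x y with em {P = P}
    ... | yes _ = x
    ... | no  _ = y

    ite-yes : ∀ {P : Set p} {x y : A} → P → ite P x y ≡ x
    ite-yes {P = P} h with em {P = P}
    ... | yes _  = refl
    ... | no  ¬h = contradiction h ¬h

    ite-no : ∀ {P : Set p} {x y : A} → ¬ P → ite P x y ≡ y
    ite-no {P = P} ¬h with em {P = P}
    ... | yes h = contradiction h ¬h
    ... | no  _ = refl

    ite-cong : ∀ {P Q : Set p} {x y x′ y′ : A} → (P → Q) → (Q → P) →
               x ≡ x′ → y ≡ y′ → ite P x y ≡ ite Q x′ y′
    ite-cong {P = P} P→Q Q→P refl refl with em {P = P}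
    ... | yes h  = sym (ite-yes (P→Q h))
    ... | no  ¬h = sym (ite-no (¬h ∘ Q→P))

    ite-elim : ∀ {P : Set p} {x y : A} (Q : Pred A r) → (P → Q x) → (¬ P → Q y) → Q (ite P x y)
    ite-elim {P = P} Q Qx Qy with em {P = P}
    ... | yes h  = Qx h
    ... | no  ¬h = Qy ¬h

    byContradiction : ∀ {P : Set p} → ¬ ¬ P → P
    byContradiction {P = P} ¬¬h with em {P = P}
    ... | yes h  = h
    ... | no  ¬h = contradiction ¬h ¬¬h

    choose : A → Pred A p → A
    choose d P with em {P = ∃ P}
    ... | yes (x , _) = x
    ... | no  _       = d

    choose-spec : ∀ {d : A} {P : Pred A p} → ∃ P → P (choose d P)
    choose-spec {P = P} h with em {P = ∃ P}
    ... | yes (_ , q) = q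
    ... | no  ¬h      = contradiction h ¬h

    choose-default : ∀ {d : A} {P : Pred A p} → ¬ ∃ P → choose d P ≡ d
    choose-default {P = P} ¬h with em {P = ∃ P}
    ... | yes h = contradiction h ¬h
    ... | no  _ = refl

    counterexample : ∀ {P : Pred A p} → ¬ (∀ x → P x) → ∃ λ x → ¬ P x
    counterexample ¬all = byContradiction λ none →
      ¬all λ x → byContradiction λ ¬Px → none (x , ¬Px)

  -- Recursion along a well-founded relation for functions of a fixed type:
  -- the values at earlier arguments are presented as a total function, which
  -- takes the value d elsewhere.
  module Recursion (ext : ∀ {a b} → Extensionality a b)
                   {x a r} {X : Set x} {A : Set a} {_◁_ : Rel X r}
                   (wf : WellFounded _◁_) (d : A) where

    cutAt : X → (X → A) → X → A
    cutAt x f y = ite (y ◁ x) (f y) d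

    module _ (step : X → (X → A) → A) where

      private
        extend : ∀ x → (∀ {y} → y ◁ x → A) → X → A
        extend x rec y with em {P = y ◁ x}
        ... | yes y◁x = rec y◁x
        ... | no  _   = d

        body : ∀ x → (∀ {y} → y ◁ x → A) → A
        body x rec = step x (extend x rec)

        extend-cong : ∀ x {rec rec′ : ∀ {y} → y ◁ x → A} →
          (∀ {y} y◁x → rec {y} y◁x ≡ rec′ y◁x) → ∀ y → extend x rec y ≡ extend x rec′ y
        extend-cong x rec≡ y with em {P = y ◁ x}
        ... | yes y◁x = rec≡ y◁x
        ... | no  _   = refl

        extend-const : ∀ x f y → extend x (λ {y} _ → f y) y ≡ cutAt x f y
        extend-const x f y with em {P = y ◁ x}
        ... | yes y◁x = sym (ite-yes y◁x)
        ... | no  y⋪x = sym (ite-no y⋪x)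

      opaque
        fix : X → A
        fix = All.wfRec wf _ (λ _ → A) body

        fix-eq : ∀ x → fix x ≡ step x (cutAt x fix)
        fix-eq x = trans
          (FixPoint.unfold-wfRec wf (λ _ → A) body
            (λ x rec≡ → cong (step x) (ext (extend-cong x rec≡))))
          (cong (step x) (ext (extend-const x fix)))

-- Ordinals below κ

module Ordinals (em : ∀ {a} → ExcludedMiddle a) (ext : ∀ {a b} → Extensionality a b)
                {ℓ} (κ : RegularUncountableCardinal ℓ) where

  open Classical em public
  open RegularUncountableCardinal κ public
  open IsStrictTotalOrder isStrictTotalOrder using (compare; irrefl)

  private
    variable
      α β γ δ ν ξ : Ord

  <-irr : ¬ (α < α)
  <-irr = irrefl refl

  ≤-<-trans : α ≤ β → β < γ → α < γ
  ≤-<-trans (inj₁ α<β) β<γ = <-trans α<β β<γ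
  ≤-<-trans (inj₂ refl) β<γ = β<γ

  <-≤-trans : α < β → β ≤ γ → α < γ
  <-≤-trans α<β (inj₁ β<γ) = <-trans α<β β<γ
  <-≤-trans α<β (inj₂ refl) = α<β

  ≤-trans : α ≤ β → β ≤ γ → α ≤ γ
  ≤-trans (inj₁ α<β) β≤γ = inj₁ (<-≤-trans α<β β≤γ)
  ≤-trans (inj₂ refl) β≤γ = β≤γ

  ≤-antisym : α ≤ β → β ≤ α → α ≡ β
  ≤-antisym (inj₂ α≡β) _ = α≡β
  ≤-antisym (inj₁ α<β) β≤α = contradiction (<-≤-trans α<β β≤α) <-irr

  ≤⇒≯ : α ≤ β → ¬ (β < α)
  ≤⇒≯ α≤β β<α = <-irr (≤-<-trans α≤β β<α)

  <⊎≥ : ∀ α β → α < β ⊎ β ≤ α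
  <⊎≥ α β with compare α β
  ... | tri< α<β _ _ = inj₁ α<β
  ... | tri≈ _ α≡β _ = inj₂ (inj₂ (sym α≡β))
  ... | tri> _ _ β<α = inj₂ (inj₁ β<α)

  ≮⇒≥ : ¬ (α < β) → β ≤ α
  ≮⇒≥ {α} {β} α≮β with <⊎≥ α β
  ... | inj₁ α<β = contradiction α<β α≮β
  ... | inj₂ β≤α = β≤α

  ≰⇒> : ¬ (α ≤ β) → β < α
  ≰⇒> {α} {β} α≰β with <⊎≥ β α
  ... | inj₁ β<α = β<α
  ... | inj₂ α≤β = contradiction α≤β α≰β

  ≤∧≢⇒< : α ≤ β → α ≢ β → α < β
  ≤∧≢⇒< (inj₁ α<β) _ = α<β
  ≤∧≢⇒< (inj₂ α≡β) α≢β = contradiction α≡β α≢β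

  <-rec : (P : Pred Ord p) → (∀ α → (∀ {β} → β < α → P β) → P α) → ∀ α → P α
  <-rec = All.wfRec wellFounded _

  opaque
    least : ∀ {P : Pred Ord p} → ∃ P → ∃ λ α → P α × (∀ β → P β → α ≤ β)
    least {P = P} (α , Pα) = <-rec (λ α → P α → ∃ λ α → P α × (∀ β → P β → α ≤ β)) go α Pα
      where
      go : ∀ α → (∀ {β} → β < α → P β → ∃ λ α → P α × (∀ β → P β → α ≤ β)) →
           P α → ∃ λ α → P α × (∀ β → P β → α ≤ β)
      go α rec Pα with em {P = ∃ λ β → β < α × P β}
      ... | yes (β , β<α , Pβ) = rec β<α Pβ
      ... | no none = α , Pα , λ β Pβ → ≮⇒≥ λ β<α → none (β , β<α , Pβ)

  private
    inhabited : Ord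
    inhabited = proj₁ (byContradiction {P = ∃ λ (α : Ord) → ⊤ {ℓ}} λ empty →
      isUncountable (mk↣ {to = λ _ → 0} λ {α} _ → contradiction (α , tt) empty))

  opaque
    0ₒ : Ord
    0ₒ = proj₁ (least {P = λ _ → ⊤ {ℓ}} (inhabited , tt))

    0ₒ≤ : ∀ α → 0ₒ ≤ α
    0ₒ≤ α = proj₂ (proj₂ (least {P = λ _ → ⊤ {ℓ}} (inhabited , tt))) α tt

  -- Regularity for the constant map with value `α` gives a bound as soon as `Below α` has an
  -- element. If instead `α` is 0 and nothing lies above it, κ has a single element and is
  -- countable.
  unbounded : ∀ α → ∃ λ β → α < β
  unbounded α with <⊎≥ 0ₒ α
  ... | inj₁ 0<α with β , α< ← isRegular α (λ _ → α) = β , α< (0ₒ Refinement., [ 0<α ])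
  ... | inj₂ α≤0 = byContradiction λ none → isUncountable
    (mk↣ {to = λ _ → 0} λ {β} {γ} _ →
      trans (≤-antisym (≮⇒≥ λ α<β → none (β , α<β)) (≤-trans α≤0 (0ₒ≤ β)))
            (≤-antisym (≤-trans α≤0 (0ₒ≤ γ)) (≮⇒≥ λ α<γ → none (γ , α<γ))))

  opaque
    suc : Ord → Ord
    suc α = proj₁ (least (unbounded α))

    <suc : ∀ α → α < suc α
    <suc α = proj₁ (proj₂ (least (unbounded α)))

    suc≤ : α < β → suc α ≤ β
    suc≤ {α} {β} = proj₂ (proj₂ (least (unbounded α))) β

  <suc⇒≤ : α < suc β → α ≤ β
  <suc⇒≤ α<sβ = ≮⇒≥ λ β<α → ≤⇒≯ (suc≤ β<α) α<sβ

  suc-isSuccessor : ∀ α → IsSuccessor κ α (suc α)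
  suc-isSuccessor α = <suc α , λ β → suc≤

  isSuccessor-unique : IsSuccessor κ α β → β ≡ suc α
  isSuccessor-unique (α<β , β-least) = ≤-antisym (β-least _ (<suc _)) (suc≤ α<β)

  suc-inj : suc α ≡ suc β → α ≡ β
  suc-inj {α} {β} eq = ≤-antisym (<suc⇒≤ (subst (α <_) eq (<suc α)))
                                 (<suc⇒≤ (subst (β <_) (sym eq) (<suc β)))

  infixl 6 _∨_
  opaque
    _∨_ : Ord → Ord → Ord
    α ∨ β = ite (α < β) β α

    ∨-elim : (P : Pred Ord p) → P α → P β → P (α ∨ β)
    ∨-elim P Pα Pβ = ite-elim P (λ _ → Pβ) (λ _ → Pα)

    ≤∨ˡ : α ≤ α ∨ β
    ≤∨ˡ {α} = ite-elim (α ≤_) inj₁ (λ _ → inj₂ refl)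

    ≤∨ʳ : β ≤ α ∨ β
    ≤∨ʳ {β} = ite-elim (β ≤_) (λ _ → inj₂ refl) ≮⇒≥

  ∨-monoˡ : α ≤ β → α ∨ γ ≤ β ∨ γ
  ∨-monoˡ {β = β} {γ} α≤β = ∨-elim (_≤ β ∨ γ) (≤-trans α≤β ≤∨ˡ) ≤∨ʳ

  ι : ℕ → Ord
  ι zero   = 0ₒ
  ι (1+ n) = suc (ι n)

  ι-mono : ∀ {m n} → m ℕ.< n → ι m < ι n
  ι-mono {m} {1+ n} m<1+n with ℕₚ.m<1+n⇒m<n∨m≡n m<1+n
  ... | inj₁ m<n  = <-trans (ι-mono m<n) (<suc _)
  ... | inj₂ refl = <suc _

  ι-inj : ∀ {m n} → ι m ≡ ι n → m ≡ n
  ι-inj {m} {n} eq with ℕₚ.<-cmp m n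
  ... | tri< m<n _ _ = contradiction (subst (_< ι n) eq (ι-mono m<n)) <-irr
  ... | tri≈ _ m≡n _ = m≡n
  ... | tri> _ _ n<m = contradiction (subst (ι n <_) eq (ι-mono n<m)) <-irr

  ≤ι : ∀ n → α ≤ ι n → ∃ λ m → ι m ≡ α
  ≤ι {α} zero α≤0 = 0 , ≤-antisym (0ₒ≤ α) α≤0
  ≤ι (1+ n) (inj₁ α<) = ≤ι n (<suc⇒≤ α<)
  ≤ι (1+ n) (inj₂ eq) = 1+ n , sym eq

  private
    infinite : ∃ λ α → ∀ n → ι n ≢ α
    infinite = byContradiction λ none →
      let index : ∀ α → ∃ λ n → ι n ≡ α
          index α = byContradiction λ ¬h → none (α , λ n eq → ¬h (n , eq))
      in isUncountable (mk↣ {to = λ α → proj₁ (index α)} λ {α} {β} eq →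
           trans (sym (proj₂ (index α))) (trans (cong ι eq) (proj₂ (index β))))

  opaque
    ω : Ord
    ω = proj₁ (least infinite)

    <ω⇒ι : α < ω → ∃ λ n → ι n ≡ α
    <ω⇒ι {α} α<ω = byContradiction λ ¬h →
      ≤⇒≯ (proj₂ (proj₂ (least infinite)) α (λ n eq → ¬h (n , eq))) α<ω

    ι<ω : ∀ n → ι n < ω
    ι<ω n = ≰⇒> λ ω≤ιn → let (m , eq) = ≤ι n ω≤ιn in proj₁ (proj₂ (least infinite)) m eq

  index : Ord → ℕ
  index α = choose 0 (λ n → ι n ≡ α)

  ι-index : α < ω → ι (index α) ≡ α
  ι-index α<ω = choose-spec (<ω⇒ι α<ω)

  -- Otherwise the `n + 1` ordinals from `ι 0` to `ι n` would all be listed by `e` on `Fin n`,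
  -- against the pigeonhole principle.
  Below-ω⇒<ω : Below-ω κ α → α < ω
  Below-ω⇒<ω {α} (n , e , e-mono , complete , _) = ≰⇒> λ ω≤α →
    let ι<α : ∀ m → ι m < α
        ι<α m = <-≤-trans (ι<ω m) ω≤α
        pos : ℕ → Fin n
        pos m = proj₁ (complete (ι<α m))
        pos-eq : ∀ m → e (pos m) ≡ ι m
        pos-eq m = proj₂ (complete (ι<α m))
        (i , j , i<j , eq) = pigeonhole (ℕₚ.n<1+n n) (pos ∘ toℕ)
        ιi≡ιj = trans (sym (pos-eq (toℕ i))) (trans (cong e eq) (pos-eq (toℕ j)))
    in <-irr (subst (_< ι (toℕ j)) ιi≡ιj (ι-mono i<j))

  opaque
    bound : ∀ α (g : Ord → Ord) → ∃ λ β → ∀ ξ → ξ < α → g ξ < β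
    bound α g with β , g<β ← isRegular α (g ∘ value) = β , λ ξ ξ<α → g<β (ξ Refinement., [ ξ<α ])

    bound₂ : ∀ α (h : Ord → Ord → Ord) → ∃ λ β → ∀ ξ η → ξ < α → η < α → h ξ η < β
    bound₂ α h with β , <β ← bound α (λ ξ → proj₁ (bound α (h ξ))) =
      β , λ ξ η ξ<α η<α → <-trans (proj₂ (bound α (h ξ)) η η<α) (<β ξ ξ<α)

    bound-ℕ : (g : ℕ → Ord) → ∃ λ β → ∀ n → g n < β
    bound-ℕ g with β , <β ← bound ω (g ∘ index) = β , λ n →
      subst (λ m → g m < β) (ι-inj (ι-index (ι<ω n))) (<β (ι n) (ι<ω n))

  sup-witness : ∀ {P : Pred Ord ℓ} → IsSup κ P γ → ξ < γ → ∃ λ δ → P δ × ξ < δ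
  sup-witness {ξ = ξ} (_ , lub) ξ<γ = byContradiction λ none →
    ≤⇒≯ (lub ξ λ {δ} Pδ → ≮⇒≥ λ ξ<δ → none (δ , Pδ , ξ<δ)) ξ<γ

  ¬IsZero⇒0< : ¬ IsZero κ α → 0ₒ < α
  ¬IsZero⇒0< ¬0 = ≰⇒> λ α≤0 → ¬0 λ β β<α → ≤⇒≯ (≤-trans α≤0 (0ₒ≤ β)) β<α

  <⇒¬IsZero : α < β → ¬ IsZero κ β
  <⇒¬IsZero α<β z = z _ α<β

  -- Closure points of a function

  ClosedUnder : (Ord → Ord) → Ord → Pred Ord ℓ
  ClosedUnder h β₀ δ = β₀ < δ × (∀ ξ → ξ < δ → h ξ < δ)

  -- For cofinality, start from the larger of `β₀` and `β`, pass ω times to a strict bound for `h`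
  -- on everything up to the current point, and take the least strict upper bound of the resulting
  -- sequence.
  closedUnder-isClub : ∀ h β₀ → IsClubIn κ U (ClosedUnder h β₀)
  closedUnder-isClub h β₀ = ((λ _ → _) , λ β _ → cofinal β) , λ γ _ γ≢0 γ-sup → closed γ≢0 γ-sup
    where
    next : Ord → Ord
    next α = suc α ∨ proj₁ (bound (suc α) h)

    module _ (β : Ord) where
      s : ℕ → Ord
      s zero   = β₀ ∨ β
      s (1+ n) = next (s n)

      h<s : ∀ n → ξ ≤ s n → h ξ < s (1+ n)
      h<s n ξ≤ = <-≤-trans (proj₂ (bound (suc (s n)) h) _ (≤-<-trans ξ≤ (<suc _))) ≤∨ʳ

      cofinal : ∃ λ γ → ClosedUnder h β₀ γ × β ≤ γ
      cofinal with δ , s<δ , δ-least ← least (bound-ℕ s) =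
        δ , (≤-<-trans ≤∨ˡ (s<δ 0) , λ ξ ξ<δ →
          -- As `δ` is the least strict bound, some `s n` is at least `ξ`, and then `s (1+ n)`
          -- bounds `h ξ`.
          let (n , ¬s<ξ) = counterexample {P = λ n → s n < ξ} λ s<ξ → ≤⇒≯ (δ-least ξ s<ξ) ξ<δ
          in <-trans (h<s n (≮⇒≥ ¬s<ξ)) (s<δ (1+ n)))
        , inj₁ (≤-<-trans ≤∨ʳ (s<δ 0))

    closed : ¬ IsZero κ γ → IsSup κ (ClosedUnder h β₀ ∩ (_< γ)) γ → ClosedUnder h β₀ γ
    closed γ≢0 γ-sup with δ , ((β₀<δ , _) , δ<γ) , _ ← sup-witness γ-sup (¬IsZero⇒0< γ≢0) =
      <-trans β₀<δ δ<γ , λ ξ ξ<γ →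
        let (δ , ((_ , h<δ) , δ<γ) , ξ<δ) = sup-witness γ-sup ξ<γ in <-trans (h<δ ξ ξ<δ) δ<γ

  -- Pairing functions and μ · μ = μ

  InjectsBelow : Pred Ord p → Ord → (Ord → Ord) → Set (p ⊔ ℓ)
  InjectsBelow Z ν j = (∀ α → Z α → j α < ν) × (∀ α β → Z α → Z β → j α ≡ j β → α ≡ β)

  IsPairing : Pred Ord p → (Ord → Ord → Ord) → Set (p ⊔ ℓ)
  IsPairing Z f = (∀ α β → Z α → Z β → Z (f α β)) ×
    (∀ α β α′ β′ → Z α → Z β → Z α′ → Z β′ → f α β ≡ f α′ β′ → α ≡ α′ × β ≡ β′)

  -- The canonical well-ordering of pairs, whose initial segments are contained
  -- in squares of smaller ordinals.
  _◁_ : Rel (Ord × Ord) ℓ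
  _◁_ = ×-Lex _≡_ _<_ (×-Lex _≡_ _<_ _<_) on λ (α , β) → α ∨ β , α , β

  ◁-wellFounded : WellFounded _◁_
  ◁-wellFounded = On.wellFounded _ (×-wellFounded wellFounded (×-wellFounded wellFounded wellFounded))

  ◁-total : ∀ x y → x ◁ y ⊎ x ≡ y ⊎ y ◁ x
  ◁-total (α , β) (α′ , β′) with compare (α ∨ β) (α′ ∨ β′)
  ... | tri< m<m′ _ _ = inj₁ (inj₁ m<m′)
  ... | tri> _ _ m′<m = inj₂ (inj₂ (inj₁ m′<m))
  ... | tri≈ _ m≡m′ _ with compare α α′
  ...   | tri< α<α′ _ _ = inj₁ (inj₂ (m≡m′ , inj₁ α<α′))
  ...   | tri> _ _ α′<α = inj₂ (inj₂ (inj₂ (sym m≡m′ , inj₁ α′<α)))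
  ...   | tri≈ _ α≡α′ _ with compare β β′
  ...     | tri< β<β′ _ _ = inj₁ (inj₂ (m≡m′ , inj₂ (α≡α′ , β<β′)))
  ...     | tri> _ _ β′<β = inj₂ (inj₂ (inj₂ (sym m≡m′ , inj₂ (sym α≡α′ , β′<β))))
  ...     | tri≈ _ β≡β′ _ = inj₂ (inj₁ (cong₂ _,_ α≡α′ β≡β′))

  ◁⇒max≤ : ∀ {x y} → x ◁ y → proj₁ x ∨ proj₂ x ≤ proj₁ y ∨ proj₂ y
  ◁⇒max≤ (inj₁ m<m′)      = inj₁ m<m′
  ◁⇒max≤ (inj₂ (m≡m′ , _)) = inj₂ m≡m′

  -- Pairs are numbered greedily along `◁`. The hypothesis `small` makes `Z` behave like an initial
  -- ordinal: pairs from below `ν` can be coded below `ν`, into which `Z` does not fit. It is used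
  -- both for initial ordinals above ω and for κ itself.
  module _ (Z : Pred Ord p)
           (small : ∀ μ → Z μ → ∃ λ ν → μ < ν × ∃ (IsPairing (_< ν)) × ¬ ∃ (InjectsBelow Z ν)) where

    private
      module R = Recursion ext ◁-wellFounded 0ₒ

      Fresh : Ord × Ord → (Ord × Ord → Ord) → Pred Ord _
      Fresh x f α = Z α × (∀ y → y ◁ x → f y ≢ α)

      step : Ord × Ord → (Ord × Ord → Ord) → Ord
      step x f = choose 0ₒ (Fresh x f)

      enum : Ord × Ord → Ord
      enum = R.fix step

      cut-eq : ∀ {x y} → y ◁ x → R.cutAt x enum y ≡ enum y
      cut-eq = ite-yes

      -- If no value were free, Z would inject into the set of earlier pairs.
      fresh : ∀ x → Z (proj₁ x) → Z (proj₂ x) → ∃ (Fresh x (R.cutAt x enum))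
      fresh x Zα Zβ = byContradiction λ none →
        let ν , m<ν , (f , f< , f-inj) , ¬inj = small _ (∨-elim Z Zα Zβ)
            earlier : ∀ α → Z α → ∃ λ y → y ◁ x × enum y ≡ α
            earlier α Zα = byContradiction λ ¬h → none
              (α , Zα , λ y y◁x eq → ¬h (y , y◁x , trans (sym (cut-eq y◁x)) eq))
            pre : Ord → Ord × Ord
            pre α = choose (0ₒ , 0ₒ) (λ y → y ◁ x × enum y ≡ α)
            pre◁ : ∀ α → Z α → pre α ◁ x
            pre◁ α Zα = proj₁ (choose-spec (earlier α Zα))
            enum-pre : ∀ α → Z α → enum (pre α) ≡ α
            enum-pre α Zα = proj₂ (choose-spec (earlier α Zα))
            fst<ν : ∀ α → Z α → proj₁ (pre α) < ν
            fst<ν α Zα = ≤-<-trans (≤-trans ≤∨ˡ (◁⇒max≤ (pre◁ α Zα))) m<ν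
            snd<ν : ∀ α → Z α → proj₂ (pre α) < ν
            snd<ν α Zα = ≤-<-trans (≤-trans ≤∨ʳ (◁⇒max≤ (pre◁ α Zα))) m<ν
        in ¬inj ( (λ α → f (proj₁ (pre α)) (proj₂ (pre α)))
                , (λ α Zα → f< _ _ (fst<ν α Zα) (snd<ν α Zα))
                , λ α β Zα Zβ eq →
                    let eq₁ , eq₂ = f-inj _ _ _ _ (fst<ν α Zα) (snd<ν α Zα) (fst<ν β Zβ) (snd<ν β Zβ) eq
                    in trans (sym (enum-pre α Zα)) (trans (cong enum (cong₂ _,_ eq₁ eq₂)) (enum-pre β Zβ)))

      enum-fresh : ∀ x → Z (proj₁ x) → Z (proj₂ x) → Fresh x (R.cutAt x enum) (enum x)
      enum-fresh x Zα Zβ = subst (Fresh x (R.cutAt x enum)) (sym (R.fix-eq step x))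
        (choose-spec (fresh x Zα Zβ))

      distinct : ∀ {x y} → Z (proj₁ x) → Z (proj₂ x) → y ◁ x → enum y ≢ enum x
      distinct Zα Zβ y◁x eq = proj₂ (enum-fresh _ Zα Zβ) _ y◁x (trans (cut-eq y◁x) eq)

    opaque
      greedy-pairing : ∃ (IsPairing Z)
      greedy-pairing = (λ α β → enum (α , β)) , (λ α β Zα Zβ → proj₁ (enum-fresh _ Zα Zβ)) , inj
        where
        inj : ∀ α β α′ β′ → Z α → Z β → Z α′ → Z β′ →
              enum (α , β) ≡ enum (α′ , β′) → α ≡ α′ × β ≡ β′
        inj α β α′ β′ Zα Zβ Zα′ Zβ′ eq with ◁-total (α , β) (α′ , β′)
        ... | inj₁ x◁y = contradiction eq (distinct Zα′ Zβ′ x◁y)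
        ... | inj₂ (inj₁ refl) = refl , refl
        ... | inj₂ (inj₂ y◁x) = contradiction (sym eq) (distinct Zα Zβ y◁x)

  -- Pairs with sum s receive values from s² to s² + s, which is below (s + 1)². So different sums
  -- occupy disjoint blocks, and `m` tells the pairs within a block apart.
  pairℕ : ℕ → ℕ → ℕ
  pairℕ m n = (m ℕ.+ n) ℕ.* (m ℕ.+ n) ℕ.+ m

  pairℕ-< : ∀ m n m′ n′ → m ℕ.+ n ℕ.< m′ ℕ.+ n′ → pairℕ m n ℕ.< pairℕ m′ n′
  pairℕ-< m n m′ n′ s<s′ = begin-strict
    s ℕ.* s ℕ.+ m      ≤⟨ ℕₚ.+-monoʳ-≤ (s ℕ.* s) (ℕₚ.m≤m+n m n) ⟩
    s ℕ.* s ℕ.+ s      ≡⟨ ℕₚ.+-comm (s ℕ.* s) s ⟩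
    1+ s ℕ.* s         <⟨ ℕₚ.*-monoʳ-< (1+ s) (ℕₚ.n<1+n s) ⟩
    1+ s ℕ.* 1+ s      ≤⟨ ℕₚ.*-mono-≤ s<s′ s<s′ ⟩
    s′ ℕ.* s′          ≤⟨ ℕₚ.m≤m+n (s′ ℕ.* s′) m′ ⟩
    s′ ℕ.* s′ ℕ.+ m′   ∎
    where
    open ℕₚ.≤-Reasoning
    s s′ : ℕ
    s  = m ℕ.+ n
    s′ = m′ ℕ.+ n′

  pairℕ-inj : ∀ m n m′ n′ → pairℕ m n ≡ pairℕ m′ n′ → m ≡ m′ × n ≡ n′
  pairℕ-inj m n m′ n′ eq with ℕₚ.<-cmp (m ℕ.+ n) (m′ ℕ.+ n′)
  ... | tri< s<s′ _ _ = contradiction eq (ℕₚ.<⇒≢ (pairℕ-< m n m′ n′ s<s′))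
  ... | tri> _ _ s′<s = contradiction (sym eq) (ℕₚ.<⇒≢ (pairℕ-< m′ n′ m n s′<s))
  ... | tri≈ _ s≡s′ _ = m≡m′ , ℕₚ.+-cancelˡ-≡ m n n′ (trans s≡s′ (cong (ℕ._+ n′) (sym m≡m′)))
    where
    m≡m′ : m ≡ m′
    m≡m′ = ℕₚ.+-cancelˡ-≡ ((m ℕ.+ n) ℕ.* (m ℕ.+ n)) m m′
      (trans eq (cong (λ s → s ℕ.* s ℕ.+ m′) (sym s≡s′)))

  pairing-ω : ∃ (IsPairing (_< ω))
  pairing-ω = (λ α β → ι (pairℕ (index α) (index β))) , (λ α β _ _ → ι<ω (pairℕ (index α) (index β)))
    , λ α β α′ β′ α< β< α′< β′< eq →
        let eq₁ , eq₂ = pairℕ-inj (index α) (index β) (index α′) (index β′) (ι-inj eq)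
        in trans (sym (ι-index α<)) (trans (cong ι eq₁) (ι-index α′<))
         , trans (sym (ι-index β<)) (trans (cong ι eq₂) (ι-index β′<))

  private
    -- Hilbert's hotel: the extra element `ν` moves to 0, finite ordinals move up by one, all others
    -- stay.
    shift : Ord → Ord → Ord
    shift ν α = ite (α ≡ ν) 0ₒ (ite (α < ω) (suc α) α)

  suc<ω : α < ω → suc α < ω
  suc<ω α<ω with n , refl ← <ω⇒ι α<ω = ι<ω (1+ n)

  suc-injectsBelow : ω ≤ ν → ∃ (InjectsBelow (_< suc ν) ν)
  suc-injectsBelow {ν} ω≤ν = shift ν , (λ α α< → view-< (view α α<)) , λ α β α< β< → view-inj (view α α<) (view β β<)
    where
    data View (α : Ord) : Ord → Set ℓ where
      top    : α ≡ ν → View α 0ₒ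
      finite : α < ω → View α (suc α)
      other  : ω ≤ α → α < ν → View α α

    view : ∀ α → α < suc ν → View α (shift ν α)
    view α α<sν = ite-elim (View α) top λ α≢ν → ite-elim (View α) finite λ α≮ω →
      other (≮⇒≥ α≮ω) (≤∧≢⇒< (<suc⇒≤ α<sν) α≢ν)

    view-< : ∀ {α x} → View α x → x < ν
    view-< (top _)       = <-≤-trans (ι<ω 0) ω≤ν
    view-< (finite α<ω)  = <-≤-trans (suc<ω α<ω) ω≤ν
    view-< (other _ α<ν) = α<ν

    view-inj : ∀ {α β x y} → View α x → View β y → x ≡ y → α ≡ β
    view-inj (top refl) (top refl) _ = refl
    view-inj (top _) (finite _) eq = contradiction (subst (_ <_) (sym eq) (<suc _)) (≤⇒≯ (0ₒ≤ _))
    view-inj (top _) (other ω≤β _) eq = contradiction (<-≤-trans (ι<ω 0) (subst (ω ≤_) (sym eq) ω≤β)) <-irr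
    view-inj (finite _) (top _) eq = contradiction (subst (_ <_) eq (<suc _)) (≤⇒≯ (0ₒ≤ _))
    view-inj (finite _) (finite _) eq = suc-inj eq
    view-inj (finite α<ω) (other ω≤β _) eq = contradiction (<-≤-trans (suc<ω α<ω) (subst (ω ≤_) (sym eq) ω≤β)) <-irr
    view-inj (other ω≤α _) (top _) eq = contradiction (<-≤-trans (ι<ω 0) (subst (ω ≤_) eq ω≤α)) <-irr
    view-inj (other ω≤α _) (finite β<ω) eq = contradiction (<-≤-trans (suc<ω β<ω) (subst (ω ≤_) eq ω≤α)) <-irr
    view-inj (other _ _) (other _ _) eq = eq

  opaque
    -- Induction on `μ`. If `μ` injects into a smaller infinite `ν`, the pairing of `ν` is carried
    -- back along the injection; otherwise `μ` is an initial ordinal and the greedy enumeration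
    -- applies.
    pairing-below : ∀ μ → ω ≤ μ → ∃ (IsPairing (_< μ))
    pairing-below = <-rec (λ μ → ω ≤ μ → ∃ (IsPairing (_< μ))) go
      where
      go : ∀ μ → (∀ {ν} → ν < μ → ω ≤ ν → ∃ (IsPairing (_< ν))) → ω ≤ μ → ∃ (IsPairing (_< μ))
      go μ rec (inj₂ refl) = pairing-ω
      go μ rec (inj₁ ω<μ) with em {P = ∃ λ ν → ω ≤ ν × ν < μ × ∃ (InjectsBelow (_< μ) ν)}
      ... | yes (ν , ω≤ν , ν<μ , j , j< , j-inj) with f , f< , f-inj ← rec ν<μ ω≤ν =
        (λ α β → f (j α) (j β)) , (λ α β α< β< → <-trans (f< _ _ (j< α α<) (j< β β<)) ν<μ)
        , λ α β α′ β′ α< β< α′< β′< eq →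
            let eq₁ , eq₂ = f-inj _ _ _ _ (j< α α<) (j< β β<) (j< α′ α′<) (j< β′ β′<) eq
            in j-inj α α′ α< α′< eq₁ , j-inj β β′ β< β′< eq₂
      ... | no initial = greedy-pairing (_< μ) λ ξ ξ<μ →
        -- An initial ordinal above ω is a limit, because an infinite successor injects into its
        -- predecessor.
        let suc< : ∀ ν → ω ≤ ν → ν < μ → suc ν < μ
            suc< ν ω≤ν ν<μ = ≤∧≢⇒< (suc≤ ν<μ) λ { refl →
              initial (ν , ω≤ν , ν<μ , suc-injectsBelow ω≤ν) }
            ν = suc (ξ ∨ ω)
            ω≤ν = ≤-trans ≤∨ʳ (inj₁ (<suc (ξ ∨ ω)))
            ν<μ = suc< (ξ ∨ ω) ≤∨ʳ (∨-elim (_< μ) ξ<μ ω<μ)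
        in ν , ≤-<-trans ≤∨ˡ (<suc (ξ ∨ ω)) , rec ν<μ ω≤ν , λ inj → initial (ν , ω≤ν , ν<μ , inj)

  ¬Ord-injectsBelow : ¬ ∃ (InjectsBelow (U {A = Ord}) ν)
  ¬Ord-injectsBelow {ν} (j , j< , j-inj) = proj₂ (isCardinal ν)
    (mk↣ {to = λ α → j α Refinement., [ j< α _ ]} λ {α} {β} eq → j-inj α β _ _ (cong value eq))

  opaque
    pairing-Ord : ∃ (IsPairing (U {A = Ord}))
    pairing-Ord = greedy-pairing U λ μ _ →
      suc (μ ∨ ω) , ≤-<-trans ≤∨ˡ (<suc _) , pairing-below _ (≤-trans ≤∨ʳ (inj₁ (<suc _))) , ¬Ord-injectsBelow

-- Climbs along a club

module Threads (em : ∀ {a} → ExcludedMiddle a) (ext : ∀ {a b} → Extensionality a b)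
               {ℓ} (κ : RegularUncountableCardinal ℓ) where

  open Ordinals em ext κ public

  private
    variable
      α β γ δ ξ : Ord
      i : ℕ
      C C′ : Pred Ord ℓ

  module R = Recursion ext wellFounded 0ₒ

  cut : Ord → (Ord → Ord) → Ord → Ord
  cut = R.cutAt

  -- A sequence of length α is represented by any function on all ordinals that
  -- prolongs it, so Agree α plays the role of equality at level α.
  Agree : Ord → Rel (Ord → Ord) ℓ
  Agree α y z = ∀ ξ → ξ < α → y ξ ≡ z ξ

  private
    variable
      x x′ y z : Ord → Ord

  Agree-refl : Agree α y y
  Agree-refl _ _ = refl

  Agree-sym : Agree α y z → Agree α z y
  Agree-sym y≈z ξ ξ<α = sym (y≈z ξ ξ<α)

  Agree-trans : Agree α x y → Agree α y z → Agree α x z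
  Agree-trans x≈y y≈z ξ ξ<α = trans (x≈y ξ ξ<α) (y≈z ξ ξ<α)

  Agree-≤ : β ≤ α → Agree α y z → Agree β y z
  Agree-≤ β≤α y≈z ξ ξ<β = y≈z ξ (<-≤-trans ξ<β β≤α)

  cut-agree : ∀ α y → Agree α (cut α y) y
  cut-agree α y ξ ξ<α = ite-yes ξ<α

  -- Turns agreement into an equality of functions, so that whatever is applied to `cut α y` depends
  -- on `y` below `α` only.
  cut-cong : Agree α y z → cut α y ≡ cut α z
  cut-cong {α} {y} {z} y≈z = ext λ ξ → case em {P = ξ < α} of λ
    { (yes ξ<α) → trans (ite-yes ξ<α) (trans (y≈z ξ ξ<α) (sym (ite-yes ξ<α)))
    ; (no ξ≮α)  → trans (ite-no ξ≮α) (sym (ite-no ξ≮α)) }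

  cut-cut : β ≤ α → cut β (cut α y) ≡ cut β y
  cut-cut {α = α} {y} β≤α = cut-cong (Agree-≤ β≤α (cut-agree α y))

  IsPred : Pred Ord ℓ → Rel Ord ℓ
  IsPred C γ β = C γ × γ < β × (∀ δ → C δ → δ < β → δ ≤ γ)

  IsPred-unique : ∀ {γ γ′} → IsPred C γ β → IsPred C γ′ β → γ ≡ γ′
  IsPred-unique (Cγ , γ<β , γ-max) (Cγ′ , γ′<β , γ′-max) =
    ≤-antisym (γ′-max _ Cγ γ<β) (γ-max _ Cγ′ γ′<β)

  -- The step of a climb from `γ` to the next point `β` is the one responsible for the value at `ξ`.
  Gap : Pred Ord ℓ → Ord → Ord → Ord → Set ℓ
  Gap C ξ γ β = IsPred C γ β × C β × γ ≤ ξ × ξ < β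

  Gap-next : ∀ {γ β β′} → Gap C ξ γ β → C β′ → ξ < β′ → β ≤ β′
  Gap-next ((_ , _ , γ-max) , _ , γ≤ξ , _) Cβ′ ξ<β′ =
    ≮⇒≥ λ β′<β → ≤⇒≯ (≤-trans (γ-max _ Cβ′ β′<β) γ≤ξ) ξ<β′

  Gap-unique : ∀ {γ γ′ β β′} → Gap C ξ γ β → Gap C ξ γ′ β′ → γ ≡ γ′ × β ≡ β′
  Gap-unique {C} g@(pred , Cβ , _ , ξ<β) g′@(pred′ , Cβ′ , _ , ξ<β′)
    with refl ← ≤-antisym (Gap-next {C} g Cβ′ ξ<β′) (Gap-next {C} g′ Cβ ξ<β) =
    IsPred-unique {C = C} pred pred′ , refl

  Steps : Pred Ord ℓ → ℕ → Pred Ord ℓ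
  Steps C zero   β = ⊤
  Steps C (1+ n) β = ∃ λ γ → IsPred C γ β × Steps C n γ

  -- Passing to immediate predecessors is a descent and ends after finitely many steps. Thus at each
  -- `β` only finitely many indices are forced away from their targets.
  Steps-finite : ∀ C β → ∃ λ N → ∀ n → N ℕ.≤ n → ¬ Steps C n β
  Steps-finite C = <-rec _ go
    where
    go : ∀ β → (∀ {γ} → γ < β → ∃ λ N → ∀ n → N ℕ.≤ n → ¬ Steps C n γ) →
         ∃ λ N → ∀ n → N ℕ.≤ n → ¬ Steps C n β
    go β rec with em {P = ∃ λ γ → IsPred C γ β}
    ... | no none = 1 , λ { (1+ n) _ (γ , pred , _) → none (γ , pred) }
    ... | yes (γ , pred@(_ , γ<β , _)) with N , ¬steps ← rec γ<β = 1+ N , λ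
      { (1+ n) (ℕ.s≤s N≤n) (γ′ , pred′ , steps) →
        ¬steps n N≤n (subst (Steps C n) (IsPred-unique {C} pred′ pred) steps) }

  EqualBelow : Ord → Rel (Pred Ord ℓ) ℓ
  EqualBelow α C C′ = ∀ γ → γ < α → (C γ → C′ γ) × (C′ γ → C γ)

  EqualBelow-sym : EqualBelow α C C′ → EqualBelow α C′ C
  EqualBelow-sym eq γ γ<α = proj₂ (eq γ γ<α) , proj₁ (eq γ γ<α)

  IsPred-cong : β ≤ α → EqualBelow α C C′ → IsPred C γ β → IsPred C′ γ β
  IsPred-cong β≤α eq (Cγ , γ<β , γ-max) =
    proj₁ (eq _ (<-≤-trans γ<β β≤α)) Cγ , γ<β ,
    λ δ C′δ δ<β → γ-max δ (proj₂ (eq δ (<-≤-trans δ<β β≤α)) C′δ) δ<β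

  Steps-cong : ∀ n → β ≤ α → EqualBelow α C C′ → Steps C n β → Steps C′ n β
  Steps-cong zero β≤α eq _ = tt
  Steps-cong {C = C} {C′} (1+ n) β≤α eq (γ , pred@(_ , γ<β , _) , steps) =
    γ , IsPred-cong {C = C} {C′} β≤α eq pred ,
    Steps-cong n (inj₁ (<-≤-trans γ<β β≤α)) eq steps

  Gap-cong : β < α → EqualBelow α C C′ → Gap C ξ γ β → Gap C′ ξ γ β
  Gap-cong {C = C} {C′} β<α eq (pred , Cβ , γ≤ξ , ξ<β) =
    IsPred-cong {C = C} {C′} (inj₁ β<α) eq pred , proj₁ (eq _ β<α) Cβ , γ≤ξ , ξ<β

  limit-suc : IsLimit κ α → ξ < α → suc ξ < α
  limit-suc {ξ = ξ} (_ , ¬suc) ξ<α =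
    ≤∧≢⇒< (suc≤ ξ<α) λ { refl → ¬suc ξ (suc-isSuccessor ξ) }

  module _ (club : IsClubIn κ (_< α) C) where

    private
      C⊆ : C β → β < α
      C⊆ = proj₁ (proj₁ club)

    opaque
      -- Let `σ` be the supremum of `C` below `β`. If `σ < β`, then `σ` lies in `C`: otherwise `C`
      -- would be cofinal in `σ`, and closedness would put `σ` into `C`.
      pred⊎sup : C δ → δ < β → β ≤ α →
                 (∃ λ γ → IsPred C γ β × δ ≤ γ) ⊎ IsSup κ (C ∩ (_< β)) β
      pred⊎sup {δ} {β} Cδ δ<β β≤α
        with σ , σ-ub , σ-least ← least {P = λ σ → ∀ γ → C γ → γ < β → γ ≤ σ} (β , λ _ _ → inj₁)
        with σ-least β (λ _ _ → inj₁)
      ... | inj₂ refl = inj₂ ((λ (_ , γ<β) → inj₁ γ<β) , λ ε ub → σ-least ε λ γ Cγ γ<β → ub (Cγ , γ<β))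
      ... | inj₁ σ<β = inj₁ (σ , (Cσ , σ<β , σ-ub) , σ-ub δ Cδ δ<β)
        where
        Cσ : C σ
        Cσ = byContradiction λ ¬Cσ →
          let below : ∀ γ → C γ → γ < β → γ < σ
              below γ Cγ γ<β = ≤∧≢⇒< (σ-ub γ Cγ γ<β) λ { refl → ¬Cσ Cγ }
          in ¬Cσ (proj₂ club σ (<-≤-trans σ<β β≤α) (<⇒¬IsZero (below δ Cδ δ<β))
               ((λ (_ , γ<σ) → inj₁ γ<σ) , λ ε ub → σ-least ε λ γ Cγ γ<β → ub (Cγ , below γ Cγ γ<β)))

      -- The right end is the least point of `C` above `ξ`. It is not a limit of `C`, since a
      -- smaller point would then already exceed `ξ`; so it has a predecessor.
      gap : IsLimit κ α → C δ → δ ≤ ξ → ξ < α → ∃ λ γ → ∃ λ β → Gap C ξ γ β × β < α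
      gap {δ} {ξ} lim Cδ δ≤ξ ξ<α
        with γ₀ , Cγ₀ , sξ≤γ₀ ← proj₂ (proj₁ club) (suc ξ) (limit-suc lim ξ<α)
        with β , (Cβ , ξ<β) , β-least ← least {P = λ β → C β × ξ < β} (γ₀ , Cγ₀ , <-≤-trans (<suc ξ) sξ≤γ₀)
        with pred⊎sup Cδ (≤-<-trans δ≤ξ ξ<β) (inj₁ (C⊆ Cβ))
      ... | inj₂ sup with γ , (Cγ , γ<β) , ξ<γ ← sup-witness sup ξ<β =
        contradiction γ<β (≤⇒≯ (β-least γ (Cγ , ξ<γ)))
      ... | inj₁ (γ , pred@(Cγ , γ<β , _) , _) =
        γ , β , (pred , Cβ , ≮⇒≥ (λ ξ<γ → ≤⇒≯ (β-least γ (Cγ , ξ<γ)) γ<β) , ξ<β) , C⊆ Cβ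

      least∈ : IsLimit κ α → ∃ λ δ → C δ × (∀ β → C β → δ ≤ β)
      least∈ lim with γ , Cγ , _ ← proj₂ (proj₁ club) 0ₒ (¬IsZero⇒0< (proj₁ lim)) = least (γ , Cγ)

  sup⇒limit : ∀ {P : Pred Ord ℓ} → δ < β → IsSup κ (P ∩ (_< β)) β → IsLimit κ β
  sup⇒limit δ<β sup = <⇒¬IsZero δ<β , λ γ γ-suc@(γ<β , _) →
    let (ε , (_ , ε<β) , γ<ε) = sup-witness sup γ<β
    in ≤⇒≯ (proj₂ γ-suc ε γ<ε) ε<β

  -- The target τ β stands for f_{u↾β}(i), and S β γ for the choice of a node at
  -- level β, above a given node of level γ, that respects the guess of ◇.
  module _ (C : Pred Ord ℓ) (S : Ord → Ord → (Ord → Ord) → Ord → Ord) (τ : Ord → Ord → Ord) (i : ℕ) where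

    Follows : Ord → Ord → (Ord → Ord) → Set ℓ
    Follows γ β p = Agree γ p (τ β) × ¬ Steps C (1+ i) β

    move : Ord → Ord → (Ord → Ord) → Ord → Ord
    move γ β p = ite (Follows γ β p) (τ β) (S β γ p)

    private
      GapAt : Ord → Pred (Ord × Ord) ℓ
      GapAt ξ (γ , β) = Gap C ξ γ β

      -- The whole continuation over a gap is recomputed at each `ξ` from the part below `γ`, and
      -- only its value at `ξ` is kept. So one recursion on ordinals suffices, and nothing special
      -- happens at accumulation points of `C`.
      threadStep : Ord → (Ord → Ord) → Ord → (Ord → Ord) → Ord
      threadStep δ x ξ y = ite (ξ < δ) (x ξ)
        (let (γ , β) = choose (0ₒ , 0ₒ) (GapAt ξ) in move γ β (cut γ y) ξ)

    opaque
      thread : Ord → (Ord → Ord) → Ord → Ord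
      thread δ x = R.fix (threadStep δ x)

      thread-base : ∀ δ x → Agree δ x (thread δ x)
      thread-base δ x ξ ξ<δ = sym (trans (R.fix-eq (threadStep δ x) ξ) (ite-yes ξ<δ))

      thread-step : ∀ δ x → δ ≤ ξ → Gap C ξ γ β → thread δ x ξ ≡ move γ β (cut γ (thread δ x)) ξ
      thread-step {ξ} {γ} {β} δ x δ≤ξ g@(_ , _ , γ≤ξ , _) = begin
        thread δ x ξ                                        ≡⟨ R.fix-eq (threadStep δ x) ξ ⟩
        threadStep δ x ξ (cut ξ (thread δ x))               ≡⟨ ite-no (≤⇒≯ δ≤ξ) ⟩
        move γ′ β′ (cut γ′ (cut ξ (thread δ x))) ξ          ≡⟨ cong (λ (γ , β) → move γ β (cut γ (cut ξ (thread δ x))) ξ)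
                                                                 chosen ⟩
        move γ β (cut γ (cut ξ (thread δ x))) ξ             ≡⟨ cong (λ p → move γ β p ξ) (cut-cut γ≤ξ) ⟩
        move γ β (cut γ (thread δ x)) ξ                     ∎
        where
        open ≡-Reasoning
        γβ′ : Ord × Ord
        γβ′ = choose (0ₒ , 0ₒ) (GapAt ξ)
        γ′ β′ : Ord
        γ′ = proj₁ γβ′
        β′ = proj₂ γβ′
        chosen : γβ′ ≡ (γ , β)
        chosen = let eq₁ , eq₂ = Gap-unique {C} (choose-spec {P = GapAt ξ} ((γ , β) , g)) g in cong₂ _,_ eq₁ eq₂

    move-forced : Steps C (1+ i) β → ∀ γ p → move γ β p ≡ S β γ p
    move-forced steps γ p = ite-no λ (_ , ¬steps) → ¬steps steps

    move-follows : Follows γ β y → move γ β y ≡ τ β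
    move-follows = ite-yes

    move-elim : ∀ γ β y (P : Pred (Ord → Ord) p) →
                (Agree γ y (τ β) → P (τ β)) → P (S β γ y) → P (move γ β y)
    move-elim γ β y P Pτ PS = ite-elim P (λ (y≈ , _) → Pτ y≈) (λ _ → PS)

  module _ {S S′ : Ord → Ord → (Ord → Ord) → Ord → Ord} {τ τ′ : Ord → Ord → Ord} where

    -- Each value beyond `δ` depends only on the gap around its position and on earlier values. As
    -- these gaps end below `α`, agreement of the data below `α` is enough. This is how coherence of
    -- the clubs comes into play.
    thread-cong : EqualBelow α C C′ →
                  (∀ ξ → δ ≤ ξ → ξ < α → ∃ λ γ → ∃ λ β → Gap C ξ γ β × β < α) →
                  (∀ β → β < α → S β ≡ S′ β) → (∀ β → β < α → τ β ≡ τ′ β) → Agree δ x x′ →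
                  Agree α (thread C S τ i δ x) (thread C′ S′ τ′ i δ x′)
    thread-cong {α} {C} {C′} {δ} {x} {x′} {i} C≡ gaps S≡ τ≡ x≈ = <-rec _ go
      where
      f f′ : Ord → Ord
      f  = thread C S τ i δ x
      f′ = thread C′ S′ τ′ i δ x′

      move-cong : β < α → ∀ γ p → move C S τ i γ β p ≡ move C′ S′ τ′ i γ β p
      move-cong {β} β<α γ p = ite-cong
        (λ (p≈ , ¬steps) → subst (Agree γ p) (τ≡ β β<α) p≈ ,
                           ¬steps ∘ Steps-cong (1+ i) (inj₁ β<α) (EqualBelow-sym {C = C} {C′} C≡))
        (λ (p≈ , ¬steps) → subst (Agree γ p) (sym (τ≡ β β<α)) p≈ ,
                           ¬steps ∘ Steps-cong (1+ i) (inj₁ β<α) C≡)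
        (τ≡ β β<α) (cong (λ S → S γ p) (S≡ β β<α))

      go : ∀ ξ → (∀ {η} → η < ξ → η < α → f η ≡ f′ η) → ξ < α → f ξ ≡ f′ ξ
      go ξ rec ξ<α with <⊎≥ ξ δ
      ... | inj₁ ξ<δ = trans (sym (thread-base C S τ i δ x ξ ξ<δ))
                         (trans (x≈ ξ ξ<δ) (thread-base C′ S′ τ′ i δ x′ ξ ξ<δ))
      ... | inj₂ δ≤ξ with γ , β , g@(_ , _ , γ≤ξ , _) , β<α ← gaps ξ δ≤ξ ξ<α = begin
        f ξ                                    ≡⟨ thread-step C S τ i δ x δ≤ξ g ⟩
        move C S τ i γ β (cut γ f) ξ           ≡⟨ cong (λ p → move C S τ i γ β p ξ) (cut-cong λ η η<γ →
                                                    rec (<-≤-trans η<γ γ≤ξ) (<-trans (<-≤-trans η<γ γ≤ξ) ξ<α)) ⟩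
        move C S τ i γ β (cut γ f′) ξ          ≡⟨ cong-app (move-cong β<α γ (cut γ f′)) ξ ⟩
        move C′ S′ τ′ i γ β (cut γ f′) ξ       ≡⟨ thread-step C′ S′ τ′ i δ x′ δ≤ξ (Gap-cong {C = C} {C′} β<α C≡ g) ⟨
        f′ ξ                                   ∎
        where open ≡-Reasoning

-- Sequences as total functions, and slim levels

module Sequences (em : ∀ {a} → ExcludedMiddle a) (ext : ∀ {a b} → Extensionality a b)
                 {ℓ} (κ : RegularUncountableCardinal ℓ) where

  open Threads em ext κ public

  private
    variable
      α β : Ord
      y z : Ord → Ord

  restrict : (Ord → Ord) → ∀ α → Seq κ
  restrict = _↾_ κ

  opaque
    pad : Seq κ → Ord → Ord
    pad (α , x) ξ with em {P = ξ < α}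
    ... | yes ξ<α = x (ξ Refinement., [ ξ<α ])
    ... | no  _   = 0ₒ

    pad-< : ∀ (x : Seq κ) {ξ} (ξ<α : ξ < proj₁ x) → pad x ξ ≡ proj₂ x (ξ Refinement., [ ξ<α ])
    pad-< (α , x) {ξ} ξ<α with em {P = ξ < α}
    ... | yes _   = refl
    ... | no  ξ≮α = contradiction ξ<α ξ≮α

  -- The bound stored in an element of `Below α` is irrelevant; excluded middle recomputes it.
  Below-elim : ∀ {q} (P : Below α → Set q) → (∀ ξ (ξ<α : ξ < α) → P (ξ Refinement., [ ξ<α ])) → ∀ ξ → P ξ
  Below-elim P h (ξ Refinement., [ ξ<α ]) = h ξ (recompute em ξ<α)

  pad-restrict : ∀ α y → Agree α (pad (restrict y α)) y
  pad-restrict α y ξ ξ<α = pad-< (restrict y α) ξ<α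

  restrict-cong : Agree α y z → restrict y α ≡ restrict z α
  restrict-cong {α} y≈z = cong (α ,_) (ext (Below-elim _ y≈z))

  restrict-injective : restrict y α ≡ restrict z α → Agree α y z
  restrict-injective {y} {α} {z} eq = Agree-trans (Agree-sym (pad-restrict α y))
    (subst (λ x → Agree α (pad x) z) (sym eq) (pad-restrict α z))

  pad-injective : ∀ (x z : Below α → Ord) → Agree α (pad (α , x)) (pad (α , z)) → x ≡ z
  pad-injective {α} x z x≈z = ext (Below-elim _ λ ξ ξ<α →
    trans (sym (pad-< (α , x) ξ<α)) (trans (x≈z ξ ξ<α) (pad-< (α , z) ξ<α)))

  restrict-pad : ∀ (x : Seq κ) → restrict (pad x) (dom κ x) ≡ x
  restrict-pad (α , x) = cong (α ,_) (pad-injective _ x (pad-restrict α (pad (α , x))))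

  ⊊⇒agree : ∀ (x y : Seq κ) → _⊊_ κ x y → Agree (dom κ x) (pad x) (pad y)
  ⊊⇒agree x y (p , refl) ξ ξ<α = trans (pad-< x ξ<α) (sym (pad-< y (<-trans ξ<α p)))

  agree⇒⊊ : ∀ (x y : Seq κ) → dom κ x < dom κ y → Agree (dom κ x) (pad x) (pad y) → _⊊_ κ x y
  agree⇒⊊ x@(α , _) y p x≈y = p , cong (α ,_) (ext (Below-elim _ λ ξ ξ<α →
    trans (sym (pad-< x ξ<α)) (trans (x≈y ξ ξ<α) (pad-< y (<-trans ξ<α p)))))

  restrict-⊊ : ∀ y → α < β → _⊊_ κ (restrict y α) (restrict y β)
  restrict-⊊ {α} {β} y α<β = agree⇒⊊ _ _ α<β
    (Agree-trans (pad-restrict α y) (Agree-sym (Agree-≤ (inj₁ α<β) (pad-restrict β y))))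

  Nodes : Set (Level.suc ℓ)
  Nodes = (Ord → Ord) → Set ℓ

  -- Slimness for representing functions: up to agreement below `α`, the level injects into max(α,
  -- ω).
  IsCoding : Ord → Nodes → ((Ord → Ord) → Ord) → Set ℓ
  IsCoding α T e = (∀ y → T y → e y < α ∨ ω) × (∀ y z → T y → T z → e y ≡ e z → Agree α y z)

  code : Ord → Nodes → (Ord → Ord) → Ord
  code α T = choose (λ _ → 0ₒ) (IsCoding α T)

  code-isCoding : ∀ {T} → ∃ (IsCoding α T) → IsCoding α T (code α T)
  code-isCoding = choose-spec

  -- A node may have several names under `R`; one of them is chosen as its code.
  coding-by : ∀ {T : Nodes} (R : (Ord → Ord) → Pred Ord ℓ) →
              (∀ y → T y → ∃ λ c → R y c × c < α ∨ ω) →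
              (∀ y z c → R y c → R z c → Agree α y z) → ∃ (IsCoding α T)
  coding-by {α} {T} R total unique = e , (λ y Ty → proj₂ (e-spec y Ty)) , λ y z Ty Tz eq →
    unique y z (e z) (subst (R y) eq (proj₁ (e-spec y Ty))) (proj₁ (e-spec z Tz))
    where
    e : (Ord → Ord) → Ord
    e y = choose 0ₒ (λ c → R y c × c < α ∨ ω)
    e-spec : ∀ y → T y → R y (e y) × e y < α ∨ ω
    e-spec y Ty = choose-spec (total y Ty)

  slim⇒coding : ∀ (T : Pred (Seq κ) ℓ) → (Lev κ T α ≼ Below α) ⊎ (Lev κ T α ≼ ℕ) →
                ∃ (IsCoding α (λ y → T (restrict y α)))
  slim⇒coding {α} T slim = coding-by (λ y c → Σ (T (restrict y α)) λ Ty → name slim (lev y Ty) ≡ c)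
    (λ y Ty → name slim (lev y Ty) , (Ty , refl) , name< slim (lev y Ty))
    λ y z c (Ty , eq) (Tz , eq′) ξ ξ<α →
      cong (λ x → value x (ξ Refinement., [ ξ<α ])) (name-inj slim (trans eq (sym eq′)))
    where
    lev : ∀ y → T (restrict y α) → Lev κ T α
    lev y Ty = y ∘ value Refinement., [ Ty ]

    name : (Lev κ T α ≼ Below α) ⊎ (Lev κ T α ≼ ℕ) → Lev κ T α → Ord
    name (inj₁ f) x = value (Injection.to f x)
    name (inj₂ f) x = ι (Injection.to f x)

    name< : ∀ s x → name s x < α ∨ ω
    name< (inj₁ f) x = <-≤-trans (Below-elim (λ ξ → value ξ < α) (λ _ ξ<α → ξ<α) (Injection.to f x)) ≤∨ˡ
    name< (inj₂ f) x = <-≤-trans (ι<ω (Injection.to f x)) ≤∨ʳ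

    name-inj : ∀ s {x x′} → name s x ≡ name s x′ → x ≡ x′
    name-inj (inj₁ f) eq = Injection.injective f (value-injective eq)
    name-inj (inj₂ f) eq = Injection.injective f (ι-inj eq)

  module _ (T : Pred (Seq κ) ℓ) {e} (coding : IsCoding α (λ y → T (restrict y α)) e) where

    private
      codeOf : Lev κ T α → Ord
      codeOf x = e (pad (α , value x))

      pad∈ : ∀ (x : Lev κ T α) → T (restrict (pad (α , value x)) α)
      pad∈ (x Refinement., [ x∈T ]) = subst T (sym (restrict-pad (α , x))) (recompute em x∈T)

      codeOf< : ∀ {β} → α ≤ β → ω ≤ β → ∀ x → codeOf x < β
      codeOf< α≤β ω≤β x = <-≤-trans (proj₁ coding _ (pad∈ x)) (∨-elim (_≤ _) α≤β ω≤β)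

    codeOf-inj : ∀ {x x′} → codeOf x ≡ codeOf x′ → x ≡ x′
    codeOf-inj {x} {x′} eq = value-injective (pad-injective _ _ (proj₂ coding _ _ (pad∈ x) (pad∈ x′) eq))

    coding⇒slim : (Lev κ T α ≼ Below α) ⊎ (Lev κ T α ≼ ℕ)
    coding⇒slim with <⊎≥ α ω
    ... | inj₂ ω≤α = inj₁ (mk↣ {to = λ x → codeOf x Refinement., [ codeOf< (inj₂ refl) ω≤α x ]}
                             (codeOf-inj ∘ cong value))
    ... | inj₁ α<ω = inj₂ (mk↣ {to = index ∘ codeOf} λ {x} {x′} eq → codeOf-inj
      (trans (sym (ι-index (finite x))) (trans (cong ι eq) (ι-index (finite x′)))))
      where
      finite : ∀ x → codeOf x < ω
      finite = codeOf< (inj₁ α<ω) (inj₂ refl)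

    coding⇒≺ : Lev κ T α ≺ Ord
    coding⇒≺ = mk↣ {to = codeOf} codeOf-inj , λ f →
      ¬Ord-injectsBelow {α ∨ ω} ( codeOf ∘ Injection.to f
                                , (λ ξ _ → codeOf< ≤∨ˡ ≤∨ʳ (Injection.to f ξ))
                                , λ _ _ _ _ eq → Injection.injective f (codeOf-inj eq))

-- The recursive construction

module Construction (em : ∀ {a} → ExcludedMiddle a) (ext : ∀ {a b} → Extensionality a b)
                    {ℓ} (κ : RegularUncountableCardinal ℓ) (V : Pred (Seq κ) ℓ)
                    (V-down : IsDownwardClosed κ V) (V-tree : IsκTree κ V) (V-slim : IsSlim κ V)
                    (P : P₁₄ κ) where

  open Sequences em ext κ public

  S C : Ord → Pred Ord ℓ
  S = proj₁ (proj₁ P)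
  C = proj₁ (proj₂ P)

  open IsProxySequence (proj₂ (proj₂ P))

  private
    variable
      α β γ δ ξ : Ord
      u v x y z : Ord → Ord

  W : Ord → Nodes
  W α u = V (restrict u α)

  W-respects : Agree α u v → W α u → W α v
  W-respects u≈v = subst V (restrict-cong u≈v)

  W-down : β ≤ α → W α u → W β u
  W-down {u = u} (inj₁ β<α) = V-down _ _ (restrict-⊊ u β<α)
  W-down (inj₂ refl) Wu = Wu

  W-nonempty : ∀ α → ∃ (W α)
  W-nonempty α with x Refinement., [ x∈V ] ← proj₁ V-tree α =
    pad (α , x) , subst V (sym (restrict-pad (α , x))) (recompute em x∈V)

  W-coding : ∃ (IsCoding α (W α))
  W-coding {α} = slim⇒coding V (V-slim α)

  pair : Ord → Ord → Ord → Ord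
  pair α = choose (λ _ _ → 0ₒ) (IsPairing (_< α ∨ ω))

  pair-isPairing : ∀ α → IsPairing (_< α ∨ ω) (pair α)
  pair-isPairing α = choose-spec (pairing-below (α ∨ ω) ≤∨ʳ)

  pair< : ξ < α ∨ ω → β < α ∨ ω → pair α ξ β < α ∨ ω
  pair< = proj₁ (pair-isPairing _) _ _

  pair-inj : ∀ {ξ β ξ′ β′} → ξ < α ∨ ω → β < α ∨ ω → ξ′ < α ∨ ω → β′ < α ∨ ω →
             pair α ξ β ≡ pair α ξ′ β′ → ξ ≡ ξ′ × β ≡ β′
  pair-inj = proj₂ (pair-isPairing _) _ _ _ _

  tag : Ord → (Ord → Ord) → ℕ → Ord
  tag α u i = pair α (code α (W α) u) (ι i)

  code< : W α u → code α (W α) u < α ∨ ω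
  code< = proj₁ (code-isCoding W-coding) _

  ι<∨ω : ∀ i → ι i < α ∨ ω
  ι<∨ω i = <-≤-trans (ι<ω i) ≤∨ʳ

  tag< : ∀ i → W α u → tag α u i < α ∨ ω
  tag< i Wu = pair< (code< Wu) (ι<∨ω i)

  tag-inj : ∀ {i j} → W α u → W α v → tag α u i ≡ tag α v j → Agree α u v × i ≡ j
  tag-inj {i = i} {j} Wu Wv eq with eq₁ , eq₂ ← pair-inj (code< Wu) (ι<∨ω i) (code< Wv) (ι<∨ω j) eq =
    proj₂ (code-isCoding W-coding) _ _ Wu Wv eq₁ , ι-inj eq₂

  -- Names of nodes translate subsets of T into sets of ordinals guessed by ◇.
  nameNode : Ord → Nodes → (Ord → Ord) → Ord
  nameNode γ T z = proj₁ pairing-Ord γ (code γ T z)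

  -- All that later levels have to know about a level, in one fixed type as `Recursion` demands.
  -- `seal γ p` is the node of this level chosen above the node `p` of level `γ`.
  record Stage : Set (Level.suc ℓ) where
    field
      nodes : Nodes
      path  : (Ord → Ord) → ℕ → Ord → Ord
      seal  : Ord → (Ord → Ord) → Ord → Ord
  open Stage

  data Kind : Pred Ord ℓ where
    isZero  : IsZero κ α → Kind α
    isSuc   : ∀ β → α ≡ suc β → Kind α
    isLimit : IsLimit κ α → Kind α

  kind : ∀ α → Kind α
  kind α with em {P = IsZero κ α}
  ... | yes z = isZero z
  ... | no ¬z with em {P = ∃ λ β → IsSuccessor κ β α}
  ...   | yes (β , s) = isSuc β (isSuccessor-unique s)
  ...   | no  ¬s      = isLimit (¬z , λ β s → ¬s (β , s))

  root : Ord → Ord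
  root α = choose 0ₒ (λ δ → C α δ × (∀ β → C α β → δ ≤ β))

  module StageAt (α : Ord) (earlier : Ord → Stage) where

    climb : ℕ → (Ord → Ord) → Ord → (Ord → Ord) → Ord → Ord
    climb i u = thread (C α) (seal ∘ earlier) (λ β → path (earlier β) (cut β u) i) i

    IsClimb : (Ord → Ord) → Ord → (Ord → Ord) → (Ord → Ord) → ℕ → Set ℓ
    IsClimb y δ x u i = C α δ × nodes (earlier δ) x × W α u × Agree α y (climb i u δ x)

    nodesAt : Kind α → Nodes
    nodesAt (isZero _)  y = ⊤
    nodesAt (isSuc β _) y = nodes (earlier β) y × y β < suc β ∨ ω
    nodesAt (isLimit _) y = ∃₂ λ δ x → ∃₂ λ u i → IsClimb y δ x u i

    pathAt : Kind α → (Ord → Ord) → ℕ → Ord → Ord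
    pathAt (isZero _)  u i ξ = 0ₒ
    pathAt (isSuc β _) u i ξ = ite (ξ < β) (path (earlier β) (cut β u) i ξ) (tag α u i)
    pathAt (isLimit _) u i   = climb i u (root α) (path (earlier (root α)) (cut (root α) u) i)

    Extends : Ord → (Ord → Ord) → Nodes
    Extends γ p y = nodesAt (kind α) y × Agree γ p y

    Guessed : Ord → Nodes
    Guessed γ z = γ < α × nodes (earlier γ) z × S α (nameNode γ (nodes (earlier γ)) z)

    Seals : Ord → (Ord → Ord) → Nodes
    Seals γ p y = Extends γ p y × ∃₂ λ δ z → γ ≤ δ × Guessed δ z × Agree δ z y

    stage : Stage
    stage = record
      { nodes = nodesAt (kind α)
      ; path  = pathAt (kind α)
      -- A continuation through a guessed node is preferred, then any node above `p`. The last
      -- default is not reached when `p` is a node of an earlier level, as it then has an extension.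
      ; seal  = λ γ p → choose (choose p (Extends γ p)) (Seals γ p) }

  blank : Stage
  blank = record { nodes = λ _ → ⊤ ; path = λ _ _ _ → 0ₒ ; seal = λ _ _ _ → 0ₒ }

  module M = Recursion ext wellFounded blank

  main : Ord → Stage
  main = M.fix StageAt.stage

  before : Ord → Ord → Stage
  before α = M.cutAt α main

  module St α = StageAt α (before α)

  main-eq : ∀ α → main α ≡ St.stage α
  main-eq = M.fix-eq StageAt.stage

  before-eq : β < α → before α β ≡ main β
  before-eq = ite-yes

  T : Ord → Nodes
  T α = nodes (main α)

  -- The cut makes F α u depend on u below α only.
  F : Ord → (Ord → Ord) → ℕ → Ord → Ord
  F α u = path (main α) (cut α u)

  -- Unfolding the recursion at successors and limits

  T-eq : ∀ α → T α ≡ St.nodesAt α (kind α)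
  T-eq α = cong nodes (main-eq α)

  F-eq : ∀ α u i → F α u i ≡ St.pathAt α (kind α) (cut α u) i
  F-eq α u i = cong (λ s → path s (cut α u) i) (main-eq α)

  F-cong : Agree α u v → ∀ i → F α u i ≡ F α v i
  F-cong {α} u≈v i = cong (λ w → path (main α) w i) (cut-cong u≈v)

  path-before : ∀ α u i → β < α → path (before α β) (cut β u) i ≡ F β u i
  path-before {β} α u i β<α = cong (λ s → path s (cut β u) i) (before-eq β<α)

  -- The kind `k` is kept arbitrary here, so that the impossible kinds can be refuted by pattern
  -- matching.
  suc-nodes : ∀ k → St.nodesAt (suc β) k y → T β y × y β < suc β ∨ ω
  suc-nodes (isZero z) _ = contradiction z (<⇒¬IsZero (<suc _))
  suc-nodes {y = y} (isSuc β eq) (Ty , y<) with refl ← suc-inj eq =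
    subst (λ s → nodes s y) (before-eq (<suc β)) Ty , y<
  suc-nodes (isLimit (_ , ¬suc)) _ = contradiction (suc-isSuccessor _) (¬suc _)

  suc-nodes⁻ : ∀ k → T β y → y β < suc β ∨ ω → St.nodesAt (suc β) k y
  suc-nodes⁻ (isZero z) _ _ = contradiction z (<⇒¬IsZero (<suc _))
  suc-nodes⁻ {y = y} (isSuc β eq) Ty y< with refl ← suc-inj eq =
    subst (λ s → nodes s y) (sym (before-eq (<suc β))) Ty , y<
  suc-nodes⁻ (isLimit (_ , ¬suc)) _ _ = contradiction (suc-isSuccessor _) (¬suc _)

  T-suc : T (suc β) y → T β y × y β < suc β ∨ ω
  T-suc {β} {y} Ty = suc-nodes (kind (suc β)) (subst (λ T → T y) (T-eq (suc β)) Ty)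

  T-suc⁻ : T β y → y β < suc β ∨ ω → T (suc β) y
  T-suc⁻ {β} {y} Ty y< = subst (λ T → T y) (sym (T-eq (suc β))) (suc-nodes⁻ (kind (suc β)) Ty y<)

  suc-path : ∀ k u i → Agree β (St.pathAt (suc β) k (cut (suc β) u) i) (F β u i) ×
                       St.pathAt (suc β) k (cut (suc β) u) i β ≡ tag (suc β) (cut (suc β) u) i
  suc-path (isZero z) _ _ = contradiction z (<⇒¬IsZero (<suc _))
  suc-path (isSuc β eq) u i with refl ← suc-inj eq =
    (λ ξ ξ<β → trans (ite-yes ξ<β) (cong-app (trans (path-before (suc β) _ i (<suc β))
                (F-cong (Agree-≤ (inj₁ (<suc β)) (cut-agree (suc β) u)) i)) ξ)) , ite-no <-irr
  suc-path (isLimit (_ , ¬suc)) _ _ = contradiction (suc-isSuccessor _) (¬suc _)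

  F-suc : ∀ u i → Agree β (F (suc β) u i) (F β u i)
  F-suc {β} u i ξ ξ<β = trans (cong-app (F-eq (suc β) u i) ξ) (proj₁ (suc-path (kind (suc β)) u i) ξ ξ<β)

  F-suc-top : ∀ u i → F (suc β) u i β ≡ tag (suc β) (cut (suc β) u) i
  F-suc-top {β} u i = trans (cong-app (F-eq (suc β) u i) β) (proj₂ (suc-path (kind (suc β)) u i))

  climb : Ord → ℕ → (Ord → Ord) → Ord → (Ord → Ord) → Ord → Ord
  climb α i u = thread (C α) (seal ∘ main) (λ β → F β u i) i

  module _ (lim : IsLimit κ α) where

    C-club : IsClubIn κ (_< α) (C α)
    C-club = club α lim

    C< : C α β → β < α
    C< = proj₁ (proj₁ C-club)

    root-least : C α (root α) × (∀ β → C α β → root α ≤ β)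
    root-least = choose-spec (least∈ C-club lim)

    climb-cong : ∀ i → C α δ → Agree δ x z → Agree α u v → Agree α (climb α i u δ x) (climb α i v δ z)
    climb-cong i Cδ x≈z u≈v = thread-cong (λ _ _ → id , id) (λ ξ → gap C-club lim Cδ)
      (λ _ _ → refl) (λ β β<α → F-cong (Agree-≤ (inj₁ β<α) u≈v) i) x≈z

    climb-before : ∀ i u → C α δ → Agree α (St.climb α i u δ x) (climb α i u δ x)
    climb-before i u Cδ = thread-cong (λ _ _ → id , id) (λ ξ → gap C-club lim Cδ)
      (λ β β<α → cong seal (before-eq β<α)) (λ β → path-before α u i) Agree-refl

    limit-nodes : ∀ k → St.nodesAt α k y →
      ∃₂ λ δ x → ∃₂ λ u i → C α δ × T δ x × W α u × Agree α y (climb α i u δ x)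
    limit-nodes (isZero z) _ = contradiction z (proj₁ lim)
    limit-nodes (isSuc β refl) _ = contradiction (suc-isSuccessor β) (proj₂ lim β)
    limit-nodes (isLimit _) (δ , x , u , i , Cδ , Tx , Wu , y≈) =
      δ , x , u , i , Cδ , subst (λ s → nodes s x) (before-eq (C< Cδ)) Tx , Wu ,
      Agree-trans y≈ (climb-before i u Cδ)

    limit-nodes⁻ : ∀ k → C α δ → T δ x → W α u → ∀ i → Agree α y (climb α i u δ x) → St.nodesAt α k y
    limit-nodes⁻ (isZero z) = contradiction z (proj₁ lim)
    limit-nodes⁻ (isSuc β refl) = contradiction (suc-isSuccessor β) (proj₂ lim β)
    limit-nodes⁻ {x = x} (isLimit _) Cδ Tx Wu i y≈ =
      _ , x , _ , i , Cδ , subst (λ s → nodes s x) (sym (before-eq (C< Cδ))) Tx , Wu ,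
      Agree-trans y≈ (Agree-sym (climb-before i _ Cδ))

    limit-path : ∀ k u i → Agree α (St.pathAt α k (cut α u) i) (climb α i u (root α) (F (root α) u i))
    limit-path (isZero z) = contradiction z (proj₁ lim)
    limit-path (isSuc β refl) = contradiction (suc-isSuccessor β) (proj₂ lim β)
    limit-path (isLimit _) u i = Agree-trans
      (climb-before i (cut α u) Croot)
      (climb-cong i Croot
        (λ ξ _ → cong-app (trans (path-before α (cut α u) i root<α)
                                 (F-cong (Agree-≤ (inj₁ root<α) (cut-agree α u)) i)) ξ)
        (cut-agree α u))
      where
      Croot : C α (root α)
      Croot = proj₁ root-least
      root<α : root α < α
      root<α = C< Croot

    T-limit : T α y → ∃₂ λ δ x → ∃₂ λ u i → C α δ × T δ x × W α u × Agree α y (climb α i u δ x)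
    T-limit {y} Ty = limit-nodes (kind α) (subst (λ T → T y) (T-eq α) Ty)

    T-limit⁻ : C α δ → T δ x → W α u → ∀ i → Agree α y (climb α i u δ x) → T α y
    T-limit⁻ {y = y} Cδ Tx Wu i y≈ = subst (λ T → T y) (sym (T-eq α)) (limit-nodes⁻ (kind α) Cδ Tx Wu i y≈)

    F-limit : ∀ u i → Agree α (F α u i) (climb α i u (root α) (F (root α) u i))
    F-limit u i = Agree-trans (λ ξ _ → cong-app (F-eq α u i) ξ) (limit-path (kind α) u i)

  T-zero : IsZero κ α → T α y
  T-zero {α} {y} z = subst (λ T → T y) (sym (T-eq α)) (zero-nodes (kind α))
    where
    zero-nodes : ∀ k → St.nodesAt α k y
    zero-nodes (isZero _) = tt
    zero-nodes (isSuc β refl) = contradiction (<suc β) (z β)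
    zero-nodes (isLimit (¬z , _)) = contradiction z ¬z

  -- This and the next two conditions restate those of `StageAt` for the finished levels.
  Guessed : Ord → Ord → Nodes
  Guessed β γ z = γ < β × T γ z × S β (nameNode γ (T γ) z)

  Extends : Ord → Ord → (Ord → Ord) → Nodes
  Extends β γ p y = T β y × Agree γ p y

  Seals : Ord → Ord → (Ord → Ord) → Nodes
  Seals β γ p y = Extends β γ p y × ∃₂ λ δ z → γ ≤ δ × Guessed β δ z × Agree δ z y

  sealed : Ord → Ord → (Ord → Ord) → Ord → Ord
  sealed β = seal (main β)

  module _ (β γ : Ord) (p : Ord → Ord) where

    private
      choice : sealed β γ p ≡ choose (choose p (St.Extends β γ p)) (St.Seals β γ p)
      choice = cong (λ s → seal s γ p) (main-eq β)

      extends : ∀ {y} → St.Extends β γ p y → Extends β γ p y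
      extends {y} = subst (λ T → T y × Agree γ p y) (sym (T-eq β))

      extends⁻ : ∀ {y} → Extends β γ p y → St.Extends β γ p y
      extends⁻ {y} = subst (λ T → T y × Agree γ p y) (T-eq β)

      guessed⁻ : ∀ {δ z} → Guessed β δ z → St.Guessed β δ z
      guessed⁻ {δ} {z} (δ<β , Tz , Sz) = δ<β ,
        subst (λ s → nodes s z × S β (nameNode δ (nodes s) z)) (sym (before-eq δ<β)) (Tz , Sz)

      guessed : ∀ {δ z} → St.Guessed β δ z → Guessed β δ z
      guessed {δ} {z} (δ<β , Tz , Sz) = δ<β ,
        subst (λ s → nodes s z × S β (nameNode δ (nodes s) z)) (before-eq δ<β) (Tz , Sz)

      seals : ∀ {y} → St.Seals β γ p y → Seals β γ p y
      seals (ext , δ , z , γ≤δ , g , z≈) = extends ext , δ , z , γ≤δ , guessed g , z≈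

      seals⁻ : ∀ {y} → Seals β γ p y → St.Seals β γ p y
      seals⁻ (ext , δ , z , γ≤δ , g , z≈) = extends⁻ ext , δ , z , γ≤δ , guessed⁻ g , z≈

    sealed-seals : ∃ (Seals β γ p) → Seals β γ p (sealed β γ p)
    sealed-seals (y , sy) = subst (Seals β γ p) (sym choice)
      (seals (choose-spec {P = St.Seals β γ p} (y , seals⁻ sy)))

    sealed-extends : ∃ (Extends β γ p) → Extends β γ p (sealed β γ p)
    sealed-extends (y , ey) with em {P = ∃ (St.Seals β γ p)}
    ... | yes s = subst (Extends β γ p) (sym choice) (extends (proj₁ (choose-spec {P = St.Seals β γ p} s)))
    ... | no ¬s = subst (Extends β γ p) (sym (trans choice (choose-default ¬s)))
                    (extends (choose-spec {P = St.Extends β γ p} (y , extends⁻ ey)))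

  -- Invariants of the levels, by simultaneous induction

  record Inv (α : Ord) : Set ℓ where
    field
      respects  : Agree α y z → T α y → T α z
      down      : β ≤ α → T α y → T β y
      extension : β ≤ α → T β x → ∃ (Extends α β x)
      path∈     : W α u → ∀ i → T α (F α u i)
      ascent    : W α u → β ≤ α → ∃ λ N → ∀ i → N ℕ.≤ i → Agree β (F β u i) (F α u i)
      coding    : ∃ (IsCoding α (T α))

  open Inv

  inv-zero : IsZero κ α → Inv α
  inv-zero {α} z = record
    { respects  = λ _ _ → T-zero z
    ; down      = λ β≤α _ → subst (λ α → T α _) (sym (β≡α β≤α)) (T-zero z)
    ; extension = λ {_} {x} β≤α _ → x , T-zero z , Agree-refl
    ; path∈     = λ _ _ → T-zero z
    ; ascent    = λ _ β≤α → 0 , λ i _ ξ ξ<β → contradiction (<-≤-trans ξ<β β≤α) (z ξ)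
    ; coding    = (λ _ → 0ₒ) , (λ _ _ → ι<∨ω 0) , λ _ _ _ _ _ ξ ξ<α → contradiction ξ<α (z ξ) }
    where
    β≡α : β ≤ α → β ≡ α
    β≡α (inj₁ β<α) = contradiction β<α (z _)
    β≡α (inj₂ eq)  = eq

  inv-suc : Inv β → Inv (suc β)
  inv-suc {β} I = record
    { respects  = respects′
    ; down      = down′
    ; extension = extension′
    ; path∈     = λ {u} Wu i → T-suc⁻ (respects I (Agree-sym (F-suc u i)) (path∈ I (W-down (inj₁ (<suc β)) Wu) i))
                    (subst (_< suc β ∨ ω) (sym (F-suc-top u i)) (tag< i (W-respects (Agree-sym (cut-agree _ u)) Wu)))
    ; ascent    = ascent′
    ; coding    = (λ y → pair (suc β) (code β (T β) y) (y β))
                , (λ y Ty → pair< (code∈ Ty) (top Ty))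
                , λ y z Ty Tz eq → let eq₁ , eq₂ = pair-inj (code∈ Ty) (top Ty) (code∈ Tz) (top Tz) eq
                  in extend-agree (proj₂ (code-isCoding (coding I)) y z (proj₁ (T-suc Ty)) (proj₁ (T-suc Tz)) eq₁) eq₂ }
    where
    extend-agree : Agree β y z → y β ≡ z β → Agree (suc β) y z
    extend-agree y≈z yβ≡zβ ξ ξ<sβ with <suc⇒≤ ξ<sβ
    ... | inj₁ ξ<β  = y≈z ξ ξ<β
    ... | inj₂ refl = yβ≡zβ

    code∈ : T (suc β) y → code β (T β) y < suc β ∨ ω
    code∈ Ty = <-≤-trans (proj₁ (code-isCoding (coding I)) _ (proj₁ (T-suc Ty))) (∨-monoˡ (inj₁ (<suc β)))

    top : T (suc β) y → y β < suc β ∨ ω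
    top Ty = proj₂ (T-suc Ty)

    respects′ : Agree (suc β) y z → T (suc β) y → T (suc β) z
    respects′ y≈z Ty = T-suc⁻ (respects I (Agree-≤ (inj₁ (<suc β)) y≈z) (proj₁ (T-suc Ty)))
      (subst (_< suc β ∨ ω) (y≈z β (<suc β)) (top Ty))

    down′ : γ ≤ suc β → T (suc β) y → T γ y
    down′ (inj₁ γ<sβ) Ty = down I (<suc⇒≤ γ<sβ) (proj₁ (T-suc Ty))
    down′ (inj₂ refl) Ty = Ty

    extension′ : γ ≤ suc β → T γ x → ∃ (Extends (suc β) γ x)
    extension′ (inj₂ refl) Tx = _ , Tx , Agree-refl
    extension′ (inj₁ γ<sβ) Tx with y , Ty , x≈y ← extension I (<suc⇒≤ γ<sβ) Tx =
      -- Cutting at `β` puts the value 0 there, which every node admits.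
      cut β y , T-suc⁻ (respects I (Agree-sym (cut-agree β y)) Ty) (subst (_< suc β ∨ ω) (sym (ite-no <-irr)) (ι<∨ω 0)) ,
      Agree-trans x≈y (Agree-sym (Agree-≤ (<suc⇒≤ γ<sβ) (cut-agree β y)))

    ascent′ : W (suc β) u → γ ≤ suc β → ∃ λ N → ∀ i → N ℕ.≤ i → Agree γ (F γ u i) (F (suc β) u i)
    ascent′ Wu (inj₂ refl) = 0 , λ _ _ → Agree-refl
    ascent′ {u} Wu (inj₁ γ<sβ) with N , asc ← ascent I (W-down (inj₁ (<suc β)) Wu) (<suc⇒≤ γ<sβ) =
      N , λ i N≤i → Agree-trans (asc i N≤i) (Agree-sym (Agree-≤ (<suc⇒≤ γ<sβ) (F-suc u i)))

  move∈ : ∀ i → W β u → Inv β → γ ≤ β → T γ y →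
          Extends β γ y (move (C α) sealed (λ β → F β u i) i γ β y)
  move∈ {β} {u} {γ} {y} {α} i Wu I γ≤β Ty = move-elim (C α) sealed (λ β → F β u i) i γ β y (Extends β γ y)
    (λ y≈ → path∈ I Wu i , y≈) (sealed-extends β γ y (extension I γ≤β Ty))

  -- By coherence, C_β is the part of C_α below `β`. As `β` is a limit of these points, every gap
  -- met below `β` also ends below `β`.
  climb-coherent : (lim : IsLimit κ α) → C α δ → δ < β → C α β → IsSup κ (C α ∩ (_< β)) β → ∀ i u x →
                   Agree β (climb α i u δ x) (climb β i u δ x)
  climb-coherent {α} {δ} {β} lim Cδ δ<β Cβ sup i u x =
    thread-cong C≡ gaps (λ _ _ → refl) (λ _ _ → refl) Agree-refl
    where
    limβ : IsLimit κ β
    limβ = sup⇒limit {P = C α} δ<β sup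

    restriction : C β ≐ (C α ∩ (_< β))
    restriction = coherent α β (Cβ , sup , <⇒¬IsZero δ<β)

    C≡ : EqualBelow β (C α) (C β)
    C≡ γ γ<β = (λ Cγ → proj₂ restriction (Cγ , γ<β)) , λ Cγ → proj₁ (proj₁ restriction Cγ)

    gaps : ∀ ξ → δ ≤ ξ → ξ < β → ∃ λ γ → ∃ λ β′ → Gap (C α) ξ γ β′ × β′ < β
    gaps ξ δ≤ξ ξ<β with γ , β′ , g , β′<β ← gap (C-club limβ) limβ (proj₂ restriction (Cδ , δ<β)) δ≤ξ ξ<β =
      γ , β′ , Gap-cong {C = C β} {C α} β′<β (EqualBelow-sym {C = C α} {C β} C≡) g , β′<β

  module Climb (lim : IsLimit κ α) (inv : ∀ {β} → β < α → Inv β)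
               (Cδ : C α δ) (Tx : T δ x) (Wu : W α u) (i : ℕ) where

    top : Ord → Ord
    top = climb α i u δ x

    step : Ord → Ord → Ord → Ord
    step γ β = move (C α) sealed (λ β → F β u i) i γ β (cut γ top)

    step∈ : IsPred (C α) γ β → C α β → T γ top → Extends β γ (cut γ top) (step γ β)
    step∈ {γ} (_ , γ<β , _) Cβ Ttop = move∈ {α = α} i (W-down (inj₁ (C< lim Cβ)) Wu) (inv (C< lim Cβ)) (inj₁ γ<β)
      (respects (inv (<-trans γ<β (C< lim Cβ))) (Agree-sym (cut-agree γ top)) Ttop)

    -- Below `γ` this holds because the move extends the node already reached; from `γ` on it is the
    -- definition of the climb.
    climb-step : IsPred (C α) γ β → C α β → δ ≤ γ → T γ top → Agree β top (step γ β)
    climb-step {γ} {β} pred Cβ δ≤γ Ttop ξ ξ<β with <⊎≥ ξ γ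
    ... | inj₁ ξ<γ = trans (sym (cut-agree γ top ξ ξ<γ)) (proj₂ (step∈ pred Cβ Ttop) ξ ξ<γ)
    ... | inj₂ γ≤ξ = thread-step (C α) sealed (λ β → F β u i) i δ x (≤-trans δ≤γ γ≤ξ) (pred , Cβ , γ≤ξ , ξ<β)

    -- At a point with a predecessor the move leads to a node. At an accumulation point the climb is
    -- a climb along C_β by coherence, hence a node by the definition of limit levels.
    climb∈ : ∀ β → C α β → δ ≤ β → T β top
    climb∈ = <-rec _ go
      where
      go : ∀ β → (∀ {γ} → γ < β → C α γ → δ ≤ γ → T γ top) → C α β → δ ≤ β → T β top
      go β rec Cβ (inj₂ refl) = respects (inv (C< lim Cβ)) (thread-base _ _ _ i δ x) Tx
      go β rec Cβ (inj₁ δ<β) with pred⊎sup (C-club lim) Cδ δ<β (inj₁ (C< lim Cβ))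
      ... | inj₁ (γ , pred@(Cγ , γ<β , _) , δ≤γ) =
        let Ttop = rec γ<β Cγ δ≤γ
        in respects (inv (C< lim Cβ)) (Agree-sym (climb-step pred Cβ δ≤γ Ttop)) (proj₁ (step∈ pred Cβ Ttop))
      ... | inj₂ sup = T-limit⁻ (sup⇒limit {P = C α} δ<β sup)
        (proj₂ (coherent α β (Cβ , sup , <⇒¬IsZero δ<β)) (Cδ , δ<β)) Tx (W-down (inj₁ (C< lim Cβ)) Wu) i
        (climb-coherent lim Cδ δ<β Cβ sup i u x)

  module _ (lim : IsLimit κ α) (inv : ∀ {β} → β < α → Inv β) where

    private
      above : β < α → ∃ λ γ → C α γ × β ≤ γ
      above = proj₂ (proj₁ (C-club lim)) _

      rootα : C α (root α)
      rootα = proj₁ (root-least lim)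

      root≤ : C α β → root α ≤ β
      root≤ = proj₂ (root-least lim) _

      Troot : W α u → ∀ i → T (root α) (F (root α) u i)
      Troot Wu = path∈ (inv (C< lim rootα)) (W-down (inj₁ (C< lim rootα)) Wu)

      respects′ : Agree α y z → T α y → T α z
      respects′ y≈z Ty with δ , x , u , i , Cδ , Tx , Wu , y≈ ← T-limit lim Ty =
        T-limit⁻ lim Cδ Tx Wu i (Agree-trans (Agree-sym y≈z) y≈)

      down′ : β ≤ α → T α y → T β y
      down′ (inj₂ refl) Ty = Ty
      down′ (inj₁ β<α) Ty
        with δ , x , u , i , Cδ , Tx , Wu , y≈ ← T-limit lim Ty
        with γ , Cγ , βδ≤γ ← above (∨-elim (_< α) β<α (C< lim Cδ)) =
        respects (inv β<α) (Agree-sym (Agree-≤ (inj₁ β<α) y≈))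
          (down (inv (C< lim Cγ)) (≤-trans ≤∨ˡ βδ≤γ) (Climb.climb∈ lim inv Cδ Tx Wu i γ Cγ (≤-trans ≤∨ʳ βδ≤γ)))

      extension′ : β ≤ α → T β x → ∃ (Extends α β x)
      extension′ (inj₂ refl) Tx = _ , Tx , Agree-refl
      extension′ (inj₁ β<α) Tx
        with γ , Cγ , β≤γ ← above β<α
        with u , Wu ← W-nonempty α
        with y , Ty , x≈y ← extension (inv (C< lim Cγ)) β≤γ Tx =
        -- The climb may start from any node at a point of the club; the index 0 and the choice of
        -- `u` are arbitrary.
        climb α 0 u γ y , T-limit⁻ lim Cγ Ty Wu 0 Agree-refl ,
        Agree-trans x≈y (Agree-≤ β≤γ (thread-base _ _ _ 0 γ y))

      -- F α u agrees with F β u by coherence if β is an accumulation point of C α,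
      -- and otherwise because almost no index is forced to ignore the target.
      ascent-C : W α u → ∀ β → C α β → ∃ λ N → ∀ i → N ℕ.≤ i → Agree β (F β u i) (F α u i)
      ascent-C {u} Wu = <-rec _ go
        where
        go : ∀ β → (∀ {γ} → γ < β → C α γ → ∃ λ N → ∀ i → N ℕ.≤ i → Agree γ (F γ u i) (F α u i)) →
             C α β → ∃ λ N → ∀ i → N ℕ.≤ i → Agree β (F β u i) (F α u i)
        go β rec Cβ with root≤ Cβ
        ... | inj₂ refl = 0 , λ i _ → Agree-trans (thread-base _ _ _ i (root α) (F (root α) u i))
                                (Agree-sym (Agree-≤ (inj₁ (C< lim Cβ)) (F-limit lim u i)))
        ... | inj₁ root<β with pred⊎sup (C-club lim) rootα root<β (inj₁ (C< lim Cβ))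
        ...   | inj₂ sup = 0 , λ i _ → Agree-trans
          (subst (λ δ → Agree β (F β u i) (climb β i u δ (F δ u i))) same-root (F-limit limβ u i))
          (Agree-trans (Agree-sym (climb-coherent lim rootα root<β Cβ sup i u _))
                       (Agree-sym (Agree-≤ (inj₁ (C< lim Cβ)) (F-limit lim u i))))
          where
          limβ : IsLimit κ β
          limβ = sup⇒limit {P = C α} root<β sup
          restriction : C β ≐ (C α ∩ (_< β))
          restriction = coherent α β (Cβ , sup , <⇒¬IsZero root<β)
          same-root : root β ≡ root α
          same-root = ≤-antisym (proj₂ (root-least limβ) (root α) (proj₂ restriction (rootα , root<β)))
                                (root≤ (proj₁ (proj₁ restriction (proj₁ (root-least limβ)))))
        ...   | inj₁ (γ , pred@(Cγ , γ<β , _) , root≤γ)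
          with N₁ , asc₁ ← rec γ<β Cγ
          with N₂ , asc₂ ← ascent (inv (C< lim Cβ)) (W-down (inj₁ (C< lim Cβ)) Wu) (inj₁ γ<β)
          with N₃ , ¬steps ← Steps-finite (C α) β =
          -- Beyond `N₁` the climb passes through f_{u↾γ}(i), beyond `N₂` this node lies below
          -- f_{u↾β}(i), and beyond `N₃` the step to `β` is not forced.
          N₁ ℕ.⊔ N₂ ℕ.⊔ N₃ , λ i N≤i →
            let N₁₂≤i = ℕₚ.≤-trans (ℕₚ.m≤m⊔n (N₁ ℕ.⊔ N₂) N₃) N≤i
                N₁≤i = ℕₚ.≤-trans (ℕₚ.m≤m⊔n N₁ N₂) N₁₂≤i
                N₂≤i = ℕₚ.≤-trans (ℕₚ.m≤n⊔m N₁ N₂) N₁₂≤i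
                N₃≤i = ℕₚ.≤-trans (ℕₚ.m≤n⊔m (N₁ ℕ.⊔ N₂) N₃) N≤i
                open Climb lim inv rootα (Troot Wu i) Wu i
                F≈top = F-limit lim u i
                cut≈ = Agree-trans (cut-agree γ top) (Agree-trans
                  (Agree-sym (Agree-≤ (inj₁ (<-trans γ<β (C< lim Cβ))) F≈top))
                  (Agree-trans (Agree-sym (asc₁ i N₁≤i)) (asc₂ i N₂≤i)))
                follows = move-follows (C α) sealed (λ β → F β u i) i
                            (cut≈ , ¬steps (1+ i) (ℕₚ.m≤n⇒m≤1+n N₃≤i))
            in Agree-sym (Agree-trans (Agree-≤ (inj₁ (C< lim Cβ)) F≈top)
                 (subst (Agree β top) follows (climb-step pred Cβ root≤γ (climb∈ γ Cγ root≤γ))))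

      ascent′ : W α u → β ≤ α → ∃ λ N → ∀ i → N ℕ.≤ i → Agree β (F β u i) (F α u i)
      ascent′ Wu (inj₂ refl) = 0 , λ _ _ → Agree-refl
      ascent′ Wu (inj₁ β<α)
        with γ , Cγ , β≤γ ← above β<α
        with N₁ , asc₁ ← ascent (inv (C< lim Cγ)) (W-down (inj₁ (C< lim Cγ)) Wu) β≤γ
        with N₂ , asc₂ ← ascent-C Wu γ Cγ =
        N₁ ℕ.⊔ N₂ , λ i N≤i → Agree-trans
          (asc₁ i (ℕₚ.≤-trans (ℕₚ.m≤m⊔n N₁ N₂) N≤i))
          (Agree-≤ β≤γ (asc₂ i (ℕₚ.≤-trans (ℕₚ.m≤n⊔m N₁ N₂) N≤i)))

      -- A climb is described by `δ`, `x`, `u` and `i`, each with a code below max(α, ω), and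
      -- pairing packs these into one ordinal. A node may have several descriptions, but each
      -- description determines its node.
      Names : (Ord → Ord) → Pred Ord ℓ
      Names y c = ∃₂ λ δ x → ∃₂ λ u i → C α δ × T δ x × W α u × Agree α y (climb α i u δ x) ×
        c ≡ pair α (pair α δ (code δ (T δ) x)) (tag α u i)

      δ< : C α δ → δ < α ∨ ω
      δ< Cδ = <-≤-trans (C< lim Cδ) ≤∨ˡ

      codeδ< : C α δ → T δ x → code δ (T δ) x < α ∨ ω
      codeδ< Cδ Tx = <-≤-trans (proj₁ (code-isCoding (coding (inv (C< lim Cδ)))) _ Tx)
                               (∨-monoˡ (inj₁ (C< lim Cδ)))

      coding′ : ∃ (IsCoding α (T α))
      coding′ = coding-by Names
        (λ y Ty → let δ , x , u , i , Cδ , Tx , Wu , y≈ = T-limit lim Ty in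
          _ , (δ , x , u , i , Cδ , Tx , Wu , y≈ , refl) ,
          pair< (pair< (δ< Cδ) (codeδ< Cδ Tx)) (tag< i Wu))
        unique
        where
        unique : ∀ y z c → Names y c → Names z c → Agree α y z
        unique y z c (δ , x , u , i , Cδ , Tx , Wu , y≈ , refl) (δ′ , x′ , u′ , i′ , Cδ′ , Tx′ , Wu′ , z≈ , eq)
          with eq₁ , eq₂ ← pair-inj (pair< (δ< Cδ) (codeδ< Cδ Tx)) (tag< i Wu)
                                    (pair< (δ< Cδ′) (codeδ< Cδ′ Tx′)) (tag< i′ Wu′) eq
          with refl , eq₃ ← pair-inj (δ< Cδ) (codeδ< Cδ Tx) (δ< Cδ′) (codeδ< Cδ′ Tx′) eq₁
          with u≈ , refl ← tag-inj {i = i} {j = i′} Wu Wu′ eq₂ =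
          Agree-trans y≈ (Agree-trans
            (climb-cong lim i Cδ (proj₂ (code-isCoding (coding (inv (C< lim Cδ)))) x x′ Tx Tx′ eq₃) u≈)
            (Agree-sym z≈))

    inv-limit : Inv α
    inv-limit = record
      { respects  = respects′
      ; down      = down′
      ; extension = extension′
      ; path∈     = λ {u} Wu i → T-limit⁻ lim rootα (Troot Wu i) Wu i (F-limit lim u i)
      ; ascent    = ascent′
      ; coding    = coding′ }

  opaque
    inv : ∀ α → Inv α
    inv = <-rec Inv λ α rec → go (kind α) rec
      where
      go : Kind α → (∀ {β} → β < α → Inv β) → Inv α
      go (isZero z)     rec = inv-zero z
      go (isSuc β refl) rec = inv-suc (rec (<suc β))
      go (isLimit lim)  rec = inv-limit lim rec

  name : Ord → (Ord → Ord) → Ord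
  name γ z = nameNode γ (T γ) z

  code∈ : T γ z → code γ (T γ) z < γ ∨ ω
  code∈ {γ} = proj₁ (code-isCoding (coding (inv γ))) _

  name-inj : T β y → T γ z → name β y ≡ name γ z → β ≡ γ × Agree β y z
  name-inj {β} Ty Tz eq with refl , eq′ ← proj₂ (proj₂ pairing-Ord) _ _ _ _ _ _ _ _ eq =
    refl , proj₂ (code-isCoding (coding (inv β))) _ _ Ty Tz eq′

  -- Sealing dense upward closed sets

  module Sealing (D : Ord → Nodes)
                 (D-up : ∀ {α β y z} → β ≤ α → T α y → Agree β z y → D β z → D α y)
                 (D-dense : ∀ β y → T β y → ∃₂ λ γ z → β ≤ γ × Extends γ β y z × D γ z) where

    private
      Names : Pred Ord ℓ
      Names ζ = ∃₂ λ γ z → T γ z × D γ z × name γ z ≡ ζ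

      Reaches : Ord → Pred Ord ℓ
      Reaches ζ γ = ∃₂ λ β y → T β y × name β y ≡ ζ × ∃ λ z → β ≤ γ × Extends γ β y z × D γ z

      -- The first term makes a closure point `δ` above ω contain the names of all nodes of levels
      -- below `δ`; the second lets each of these nodes be extended into `D` below `δ`.
      closure : Ord → Ord
      closure ξ = proj₁ (bound₂ (suc ξ) (proj₁ pairing-Ord)) ∨ choose 0ₒ (Reaches ξ)

      name-closed : ClosedUnder closure ω δ → γ < δ → T γ z → name γ z < δ
      name-closed {δ} {γ} {z} (ω<δ , closed) γ<δ Tz =
        <-≤-trans (proj₂ (bound₂ (suc ζ) (proj₁ pairing-Ord)) γ c (≤-<-trans ≤∨ˡ (<suc ζ)) (≤-<-trans ≤∨ʳ (<suc ζ)))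
          (≤-trans ≤∨ˡ (inj₁ (closed ζ (∨-elim (_< δ) γ<δ (<-trans (code∈ Tz) (∨-elim (_< δ) γ<δ ω<δ))))))
        where
        c ζ : Ord
        c = code γ (T γ) z
        ζ = γ ∨ c

      reach : ClosedUnder closure ω δ → γ < δ → T γ y →
              ∃₂ λ η z → η < δ × γ ≤ η × Extends η γ y z × D η z
      reach {δ} {γ} {y} cl γ<δ Ty
        with β , y′ , Ty′ , eq , z , β≤η , (Tz , y′≈z) , Dz ←
          choose-spec {d = 0ₒ} {P = Reaches (name γ y)}
            (let η , z , γ≤η , ez , Dz = D-dense γ y Ty in η , γ , y , Ty , refl , z , γ≤η , ez , Dz)
        -- The choice inside `closure` knows `y` only through its name, which determines the level
        -- and the node up to agreement.
        with refl , y′≈y ← name-inj Ty′ Ty eq =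
        _ , z , ≤-<-trans ≤∨ʳ (proj₂ cl _ (name-closed cl γ<δ Ty)) , β≤η , (Tz , Agree-trans (Agree-sym y′≈y) y′≈z) , Dz

      Good : Pred Ord ℓ
      Good δ = ((Names ∩ (_< δ)) ≐ S δ) × ClosedUnder closure ω δ

      -- ◇ guesses `Names` on a stationary set, which meets the club of closure points above
      -- `ω ∨ β`.
      good-cofinal : IsCofinalIn κ U Good
      good-cofinal = (λ _ → _) , λ β _ →
        let δ , guess , β<δ , closed = proj₂ (proj₂ (proj₁ P)) Names
              (ClosedUnder closure (ω ∨ β)) (closedUnder-isClub closure (ω ∨ β))
        in δ , (guess , ≤-<-trans ≤∨ˡ β<δ , closed) , inj₁ (≤-<-trans ≤∨ʳ β<δ)

      opaque
        -- Some extension of `y` below `δ` lies in `D`, and its name is guessed, so a sealing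
        -- continuation exists. The one chosen passes through a guessed node, which lies in `D`
        -- because the guess is correct.
        sealed∈D : Good δ → γ < δ → T γ y → D δ (sealed δ γ y)
        sealed∈D {δ} {γ} {y} (guess , cl) γ<δ Ty
          with η , z , η<δ , γ≤η , (Tz , y≈z) , Dz ← reach cl γ<δ Ty
          with w , Tw , z≈w ← extension (inv δ) (inj₁ η<δ) Tz
          with (Ts , _) , η′ , z′ , _ , (η′<δ , Tz′ , Sz′) , z′≈s ← sealed-seals δ γ y
            (w , (Tw , Agree-trans y≈z (Agree-≤ γ≤η z≈w)) , η , z , γ≤η ,
             (η<δ , Tz , proj₁ guess ((η , z , Tz , Dz , refl) , name-closed cl η<δ Tz)) , z≈w)
          with η″ , z″ , Tz″ , Dz″ , eq ← proj₁ (proj₂ guess Sz′)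
          with refl , z″≈z′ ← name-inj Tz″ Tz′ eq =
          D-up (inj₁ η′<δ) Ts (Agree-trans z″≈z′ z′≈s) Dz″

      Hit : Ord → Pred Ord ℓ
      Hit α β = β ∈ C α × succ-ω κ (C α ∖ (_< β)) ⊆ Good

      opaque
        -- The closure points of `suc` above 0 form a club of limit ordinals, which the stationary
        -- set of hitting points meets.
        hit : ∃ λ α → IsLimit κ α × IsSup κ (Hit α) α
        hit with α , sup , 0<α , suc-closed ← hitting Good good-cofinal
                   (ClosedUnder suc 0ₒ) (closedUnder-isClub suc 0ₒ) =
          α , (<⇒¬IsZero 0<α , λ β s → <-irr (subst (suc β <_) (isSuccessor-unique s) (suc-closed β (proj₁ s)))) , sup

      module Run (lim : IsLimit κ α) (Cβ : C α β) where

        opaque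
          next : ∀ {ξ} → C α ξ → ∃ λ β′ → IsPred (C α) ξ β′ × C α β′
          next Cξ with γ , β′ , (pred@(Cγ , γ<β′ , γ-max) , Cβ′ , γ≤ξ , ξ<β′) , _ ←
                         gap (C-club lim) lim Cξ (inj₂ refl) (C< lim Cξ)
            with refl ← ≤-antisym γ≤ξ (γ-max _ Cξ ξ<β′) = β′ , pred , Cβ′

        run : ℕ → ∃ (C α)
        run zero   = β , Cβ
        run (1+ n) = let β′ , _ , Cβ′ = next (proj₂ (run n)) in β′ , Cβ′

        e : ℕ → Ord
        e n = proj₁ (run n)

        e-pred : ∀ n → IsPred (C α) (e n) (e (1+ n))
        e-pred n = proj₁ (proj₂ (next (proj₂ (run n))))

        e-steps : ∀ n → Steps (C α) n (e n)
        e-steps zero   = tt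
        e-steps (1+ n) = e n , e-pred n , e-steps n

        e-mono : ∀ {m n} → m ℕ.< n → e m < e n
        e-mono {m} {1+ n} m<1+n with ℕₚ.m<1+n⇒m<n∨m≡n m<1+n
        ... | inj₁ m<n  = <-trans (e-mono m<n) (proj₁ (proj₂ (e-pred n)))
        ... | inj₂ refl = proj₁ (proj₂ (e-pred n))

        β≤e : ∀ n → β ≤ e n
        β≤e zero   = inj₂ refl
        β≤e (1+ n) = ≤-trans (β≤e n) (inj₁ (proj₁ (proj₂ (e-pred n))))

        e-complete : ∀ n {γ} → C α γ → β ≤ γ → γ < e n → ∃ λ (i : Fin n) → e (toℕ i) ≡ γ
        e-complete zero Cγ β≤γ γ<β = contradiction γ<β (≤⇒≯ β≤γ)
        e-complete (1+ n) {γ} Cγ β≤γ γ<e with proj₂ (proj₂ (e-pred n)) γ Cγ γ<e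
        ... | inj₂ refl = Fin.fromℕ n , cong e (toℕ-fromℕ n)
        ... | inj₁ γ<en with i , eq ← e-complete n Cγ β≤γ γ<en =
          Fin.inject₁ i , trans (cong e (toℕ-inject₁ i)) eq

        -- The first point `β` of the block has nothing before it and is no ω-successor, hence the
        -- shift to `1+ n`.
        e-succ : ∀ n → succ-ω κ (C α ∖ (_< β)) (e (1+ n))
        e-succ n = (proj₂ (run (1+ n)) , ≤⇒≯ (β≤e (1+ n))) , n , e ∘ toℕ , e-mono ,
          (λ ((Cγ , γ≮β) , γ<e) → e-complete (1+ n) Cγ (≮⇒≥ γ≮β) γ<e) ,
          λ { (i , refl) → (proj₂ (run (toℕ i)) , ≤⇒≯ (β≤e (toℕ i))) , e-mono (toℕ<n i) }

      -- The point `e (1+ i)` has `1+ i` consecutive predecessors, one more than the index `i`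
      -- tolerates. So the climb moves to a sealed node there, and since the point is good, this
      -- node lies in `D`.
      climb∈D : (lim : IsLimit κ α) → C α δ → T δ x → W α u → ∀ i → Hit α β → δ < β →
                T α y → Agree α y (climb α i u δ x) → D α y
      climb∈D {α} {δ} {x} {u} {β} lim Cδ Tx Wu i (Cβ , hits) δ<β Ty y≈ =
        D-up (inj₁ β′<α) Ty (Agree-sym (Agree-trans (Agree-≤ (inj₁ β′<α) y≈) top≈))
          (sealed∈D (hits (e-succ i)) (proj₁ (proj₂ (e-pred i))) Tcut)
        where
        open Run lim Cβ
        open Climb lim (λ {β} _ → inv β) Cδ Tx Wu i

        β′<α : e (1+ i) < α
        β′<α = C< lim (proj₂ (run (1+ i)))

        δ≤γ : δ ≤ e i
        δ≤γ = ≤-trans (inj₁ δ<β) (β≤e i)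

        Ttop : T (e i) top
        Ttop = climb∈ (e i) (proj₂ (run i)) δ≤γ

        Tcut : T (e i) (cut (e i) top)
        Tcut = respects (inv (e i)) (Agree-sym (cut-agree (e i) top)) Ttop

        top≈ : Agree (e (1+ i)) top (sealed (e (1+ i)) (e i) (cut (e i) top))
        top≈ = subst (Agree (e (1+ i)) top)
          (move-forced (C α) sealed (λ β → F β u i) i (e-steps (1+ i)) (e i) (cut (e i) top))
          (climb-step (e-pred i) (proj₂ (run (1+ i))) δ≤γ Ttop)

    opaque
      sealing : ∃ λ α → ∀ y → T α y → D α y
      sealing with α , lim , sup ← hit = α , λ y Ty →
        let δ , x , u , i , Cδ , Tx , Wu , y≈ = T-limit lim Ty
            -- Hits are unbounded in `α`, so some block begins after the start of the climb.
            β , hitβ , δ<β = sup-witness sup (C< lim Cδ)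
        in climb∈D lim Cδ Tx Wu i hitβ δ<β Ty y≈

  -- The tree as a set of sequences

  tree : Pred (Seq κ) ℓ
  tree x = T (dom κ x) (pad x)

  tree-restrict : T α y → restrict y α ∈ tree
  tree-restrict {α} {y} = respects (inv α) (Agree-sym (pad-restrict α y))

  tree-restrict⁻ : restrict y α ∈ tree → T α y
  tree-restrict⁻ {y} {α} = respects (inv α) (pad-restrict α y)

  restrict-⊊′ : α < β → Agree α y z → _⊊_ κ (restrict y α) (restrict z β)
  restrict-⊊′ {β = β} {z = z} α<β y≈z =
    subst (λ x → _⊊_ κ x (restrict z β)) (sym (restrict-cong y≈z)) (restrict-⊊ z α<β)

  tree-down : IsDownwardClosed κ tree
  tree-down x y x⊊y@(p , _) Ty =
    respects (inv (dom κ x)) (Agree-sym (⊊⇒agree x y x⊊y)) (down (inv (dom κ y)) (inj₁ p) Ty)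

  tree-prolific : IsProlific κ tree
  tree-prolific x@(α , _) Tx i small y@(_ , _) (α⁺ , x⊊y@(p , _) , y-top) with refl ← isSuccessor-unique α⁺ =
    T-suc⁻ (respects (inv α) (⊊⇒agree x y x⊊y) Tx)
      (subst (_< suc α ∨ ω) (sym (trans (pad-< y p) (y-top p))) (i< small))
    where
    i< : Below-ω κ i ⊎ i < α → i < suc α ∨ ω
    i< (inj₁ i<ω) = <-≤-trans (Below-ω⇒<ω i<ω) ≤∨ʳ
    i< (inj₂ i<α) = <-≤-trans (<-trans i<α (<suc α)) ≤∨ˡ

  tree-coding : IsCoding α (λ y → tree (restrict y α)) (code α (T α))
  tree-coding {α} with e< , e-inj ← code-isCoding (coding (inv α)) =
    (λ y y∈ → e< y (tree-restrict⁻ y∈)) , λ y z y∈ z∈ → e-inj y z (tree-restrict⁻ y∈) (tree-restrict⁻ z∈)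

  tree-slim : IsSlim κ tree
  tree-slim α = coding⇒slim tree tree-coding

  tree-isκTree : IsκTree κ tree
  tree-isκTree = nonempty , λ α → coding⇒≺ tree tree-coding
    where
    nonempty : ∀ α → Lev κ tree α
    nonempty α with u , Wu ← W-nonempty α =
      F α u 0 ∘ value Refinement., [ tree-restrict (path∈ (inv α) Wu 0) ]

  -- Cofinal branches and antichains

  extendBy : Ord → Ord → (Ord → Ord) → Ord → Ord
  extendBy β c y ξ = ite (ξ < β) (y ξ) c

  extendBy-extends : ∀ n → T β y → Extends (suc β) β y (extendBy β (ι n) y)
  extendBy-extends {β} n Ty = T-suc⁻ (respects (inv β) (Agree-sym agree) Ty)
    (subst (_< suc β ∨ ω) (sym (ite-no <-irr)) (ι<∨ω n)) , Agree-sym agree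
    where
    agree : Agree β (extendBy β (ι n) _) _
    agree ξ ξ<β = ite-yes ξ<β

  module _ (B : Pred (Seq κ) ℓ) (branch : IsCofinalBranch κ tree B) where

    private
      Off : Ord → Nodes
      Off α y = ¬ B (restrict y α)

      chain : IsChain κ B
      chain = proj₁ (proj₂ branch)

      same-length : ∀ α → B (restrict y α) → B (restrict z α) → Agree α y z
      same-length {y} {z} α By Bz with chain _ _ By Bz
      ... | inj₁ (p , _) = contradiction p <-irr
      ... | inj₂ (inj₂ (p , _)) = contradiction p <-irr
      ... | inj₂ (inj₁ eq) = restrict-injective eq

      branch-down : β ≤ α → B (restrict y α) → B (restrict y β)
      branch-down (inj₂ refl) By = By
      branch-down {β} {α} {y} (inj₁ β<α) By with (.β , x) , Bx , refl ← proj₂ (proj₂ branch) β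
        with chain _ _ Bx By
      ... | inj₁ x⊊y = subst B (sym (trans
        (restrict-cong (Agree-trans (Agree-sym (Agree-≤ (inj₁ β<α) (pad-restrict α y))) (Agree-sym (⊊⇒agree _ _ x⊊y))))
        (restrict-pad (β , x)))) Bx
      ... | inj₂ (inj₁ refl) = contradiction β<α <-irr
      ... | inj₂ (inj₂ (α<β , _)) = contradiction (<-trans β<α α<β) <-irr

      off-up : β ≤ α → T α y → Agree β z y → Off β z → Off α y
      off-up β≤α _ z≈y ¬Bz By = ¬Bz (subst B (restrict-cong (Agree-sym z≈y)) (branch-down β≤α By))

      -- Of the immediate successors of `y` by 0 and by 1, the chain `B` contains at most one.
      off-dense : ∀ β y → T β y → ∃₂ λ γ z → β ≤ γ × Extends γ β y z × Off γ z
      off-dense β y Ty with em {P = B (restrict (extendBy β (ι 0) y) (suc β))}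
      ... | no ¬B₀ = suc β , _ , inj₁ (<suc β) , extendBy-extends 0 Ty , ¬B₀
      ... | yes B₀ = suc β , _ , inj₁ (<suc β) , extendBy-extends 1 Ty , λ B₁ →
        contradiction (ι-inj {0} {1} (trans (sym (ite-no <-irr))
          (trans (same-length (suc β) B₀ B₁ β (<suc β)) (ite-no <-irr)))) λ ()

    -- Sealing yields a level disjoint from `B`, although `B` has an element on every level.
    no-cofinal-branch : ⊥
    no-cofinal-branch with α , off ← Sealing.sealing Off off-up off-dense
      with x , Bx , refl ← proj₂ (proj₂ branch) α =
      off (pad x) (proj₁ branch Bx) (subst B (sym (restrict-pad x)) Bx)

  module _ (A : Pred (Seq κ) ℓ) (A⊆ : A ⊆ tree) (antichain : IsAntichain κ A) where

    private
      -- The second alternative covers antichains that are not maximal.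
      Decided : Ord → Nodes
      Decided α y = (∃ λ x → A x × dom κ x ≤ α × Agree (dom κ x) (pad x) y)
                  ⊎ (∀ x → A x → α ≤ dom κ x → ¬ Agree α y (pad x))

      decided-up : β ≤ α → T α y → Agree β z y → Decided β z → Decided α y
      decided-up β≤α _ z≈y (inj₁ (x , Ax , x≤β , x≈z)) =
        inj₁ (x , Ax , ≤-trans x≤β β≤α , Agree-trans x≈z (Agree-≤ x≤β z≈y))
      decided-up β≤α _ z≈y (inj₂ none) =
        inj₂ λ x Ax α≤x y≈x → none x Ax (≤-trans β≤α α≤x) (Agree-trans z≈y (Agree-≤ β≤α y≈x))

      decided-dense : ∀ β y → T β y → ∃₂ λ γ z → β ≤ γ × Extends γ β y z × Decided γ z
      decided-dense β y Ty with em {P = ∃ λ x → A x × β ≤ dom κ x × Agree β y (pad x)}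
      ... | yes (x , Ax , β≤x , y≈x) =
        dom κ x , pad x , β≤x , (A⊆ Ax , y≈x) , inj₁ (x , Ax , inj₂ refl , Agree-refl)
      ... | no none = β , y , inj₂ refl , (Ty , Agree-refl) ,
        inj₂ λ x Ax β≤x y≈x → none (x , Ax , β≤x , y≈x)

      -- Take a level `α` of decided nodes. If `x` in `A` were longer, its restriction to `α` would
      -- either lie above an element of `A`, comparable with `x`, or have no element of `A` above
      -- it, though `x` is one.
      bounded-length : ∃ λ α → ∀ x → A x → dom κ x ≤ α
      bounded-length with α , decided ← Sealing.sealing Decided decided-up decided-dense =
        α , λ x Ax → ≮⇒≥ λ α<x → short x Ax α<x (decided (pad x) (down (inv (dom κ x)) (inj₁ α<x) (A⊆ Ax)))
        where
        short : ∀ x → A x → α < dom κ x → ¬ Decided α (pad x)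
        short x Ax α<x (inj₁ (x′ , Ax′ , x′≤α , x′≈x)) =
          antichain x′ x Ax′ Ax (agree⇒⊊ x′ x (≤-<-trans x′≤α α<x) x′≈x)
        short x Ax α<x (inj₂ none) = none x Ax (inj₁ α<x) Agree-refl

    -- All elements of `A` have length at most `α`, so their names are pairs of ordinals below
    -- `suc α ∨ ω` and are bounded by a single `ν` below κ. Thus `A` is too small to biject with κ.
    no-big-antichain : ¬ (Refinement.Refinement (Seq κ) A ↔ Ord)
    no-big-antichain A↔Ord with α , short ← bounded-length
      with ν , <ν ← bound₂ (suc α ∨ ω) (proj₁ pairing-Ord) =
      ¬Ord-injectsBelow {ν} (nameOf ∘ member , (λ ξ _ → name< (member ξ) (member∈ ξ)) , inj)
      where
      nameOf : Seq κ → Ord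
      nameOf x = name (dom κ x) (pad x)

      name< : ∀ x → A x → nameOf x < ν
      name< x Ax = <ν _ _ (<-≤-trans x<sα ≤∨ˡ) (<-≤-trans (code∈ (A⊆ Ax)) (∨-monoˡ (inj₁ x<sα)))
        where
        x<sα : dom κ x < suc α
        x<sα = ≤-<-trans (short x Ax) (<suc α)

      nameOf-inj : ∀ x z → A x → A z → nameOf x ≡ nameOf z → x ≡ z
      nameOf-inj (_ , x) (_ , z) Ax Az eq with refl , x≈z ← name-inj (A⊆ Ax) (A⊆ Az) eq =
        cong (_ ,_) (pad-injective x z x≈z)

      member : Ord → Seq κ
      member ξ = value (Inverse.from A↔Ord ξ)

      member∈ : ∀ ξ → A (member ξ)
      member∈ ξ with x Refinement., [ Ax ] ← Inverse.from A↔Ord ξ = recompute em Ax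

      inj : ∀ ξ η → ξ ∈ U → η ∈ U → nameOf (member ξ) ≡ nameOf (member η) → ξ ≡ η
      inj ξ η _ _ eq = trans (sym (Inverse.strictlyInverseˡ A↔Ord ξ)) (trans
        (cong (Inverse.to A↔Ord) (value-injective (nameOf-inj _ _ (member∈ ξ) (member∈ η) eq)))
        (Inverse.strictlyInverseˡ A↔Ord η))

  tree-isSouslin : IsSouslin κ tree
  tree-isSouslin = record
    { isκTree         = tree-isκTree
    ; noCofinalBranch = no-cofinal-branch
    ; noBigAntichain  = no-big-antichain }

  -- The ascent path

  cofinite : ∀ {Z : Pred ℕ ℓ} → (∃ λ N → ∀ i → N ℕ.≤ i → Z i) → 𝓕fin Z
  cofinite (N , Z≥N) = upTo N , λ ¬Zi → ∈-upTo⁺ (ℕₚ.≰⇒> λ N≤i → ¬Zi (Z≥N _ N≤i))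

  member : ∀ (x : Refinement.Refinement (Seq κ) V) → W (dom κ (value x)) (pad (value x))
  member (x Refinement., [ x∈V ]) = subst V (sym (restrict-pad x)) (recompute em x∈V)

  ascentPath : PathFamily κ 𝓕fin V tree
  ascentPath x i = F (dom κ (value x)) (pad (value x)) i ∘ value
    Refinement., [ tree-restrict (path∈ (inv _) (member x) i) ]

  ¬Agree⇒differ : ¬ Agree α u v → ∃ λ ξ → ξ < α × u ξ ≢ v ξ
  ¬Agree⇒differ u≉v = byContradiction λ none → u≉v λ ξ ξ<α → byContradiction λ u≢v → none (ξ , ξ<α , u≢v)

  -- If `u` and `v` differ at `ξ`, their tags at level `suc ξ` differ for every index, and for
  -- almost all indices the ascent carries this difference up to level `α`.
  F-separates : W α u → W α v → ¬ Agree α u v →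
                ∃ λ N → ∀ i → N ℕ.≤ i → ¬ Agree α (F α u i) (F α v i)
  F-separates {α} {u} {v} Wu Wv u≉v
    with ξ , ξ<α , uξ≢vξ ← ¬Agree⇒differ u≉v
    with N₁ , asc₁ ← ascent (inv α) Wu (suc≤ ξ<α)
    with N₂ , asc₂ ← ascent (inv α) Wv (suc≤ ξ<α) =
    N₁ ℕ.⊔ N₂ , λ i N≤i F≈ → uξ≢vξ (agree-at ξ i (
      trans (asc₁ i (ℕₚ.≤-trans (ℕₚ.m≤m⊔n N₁ N₂) N≤i) ξ (<suc ξ)) (trans (F≈ ξ ξ<α)
        (sym (asc₂ i (ℕₚ.≤-trans (ℕₚ.m≤n⊔m N₁ N₂) N≤i) ξ (<suc ξ))))) ξ<α)
    where
    agree-at : ∀ ξ i → F (suc ξ) u i ξ ≡ F (suc ξ) v i ξ → ξ < α → u ξ ≡ v ξ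
    agree-at ξ i eq ξ<α = Agree-trans (Agree-sym (cut-agree (suc ξ) u)) (Agree-trans
      (proj₁ (tag-inj {i = i} {j = i} (cut∈ Wu) (cut∈ Wv)
        (trans (sym (F-suc-top u i)) (trans eq (F-suc-top v i)))))
      (cut-agree (suc ξ) v)) ξ (<suc ξ)
      where
      cut∈ : ∀ {w} → W α w → W (suc ξ) (cut (suc ξ) w)
      cut∈ Wu = W-respects (Agree-sym (cut-agree (suc ξ) _)) (W-down (suc≤ ξ<α) Wu)

  ascentPath-isAscentPath : IsAscentPath κ 𝓕fin V tree ascentPath
  ascentPath-isAscentPath = record { ascending = ascending ; separated = separated }
    where
    ascending : ∀ x x′ → _⊊_ κ (value x) (value x′) →
                𝓕fin λ i → _⊊_ κ (node κ 𝓕fin V tree ascentPath x i) (node κ 𝓕fin V tree ascentPath x′ i)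
    ascending x x′ x⊊x′@(p , _) with N , asc ← ascent (inv _) (member x′) (inj₁ p) =
      cofinite (N , λ i N≤i → restrict-⊊′ p
        (Agree-trans (λ ξ _ → cong-app (F-cong (⊊⇒agree _ _ x⊊x′) i) ξ) (asc i N≤i)))

    separated : ∀ x x′ → value x ≢ value x′ → dom κ (value x) ≡ dom κ (value x′) →
                𝓕fin λ i → node κ 𝓕fin V tree ascentPath x i ≢ node κ 𝓕fin V tree ascentPath x′ i
    separated x@((α , f) Refinement., _) x′@((α′ , f′) Refinement., _) x≢x′ refl
      with N , sep ← F-separates (member x) (member x′) (λ x≈x′ → x≢x′ (cong (α ,_) (pad-injective f f′ x≈x′))) =
      cofinite (N , λ i N≤i eq → sep i N≤i (restrict-injective eq))

  -- Level 1 works for every `b`, with all of ℕ as the cofinite set: the value at 0 is a tag, and it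
  -- determines the index.
  ascentPath-isInjective : IsInjectivePath κ 𝓕fin V tree ascentPath
  ascentPath-isInjective b b∈V = suc 0ₒ , (λ _ → ⊤) , cofinite (0 , λ _ _ → tt) , λ i j _ _ eq →
    let u  = pad (restrict b (suc 0ₒ))
        Wu = W-respects (Agree-sym (cut-agree (suc 0ₒ) u))
               (member (restrict b (suc 0ₒ) Refinement., [ b∈V (suc 0ₒ) ]))
        F≈ = restrict-injective (cong (λ f → suc 0ₒ , value f) eq)
    in proj₂ (tag-inj Wu Wu (trans (sym (F-suc-top u i)) (trans (F≈ 0ₒ (<suc 0ₒ)) (F-suc-top u j))))

theorem4p2 : (∀ {a} → ExcludedMiddle a) →
    (∀ {a b} → Extensionality a b) →
    ∀ {ℓ} (κ : RegularUncountableCardinal ℓ) (U : Pred (Seq κ) ℓ) →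
    IsDownwardClosed κ U →
    IsκTree κ U →
    IsSlim κ U →
    P₁₄ κ →
    Σ[ T ∈ Pred (Seq κ) ℓ ]
    IsDownwardClosed κ T ×
    IsProlific κ T ×
    IsSlim κ T ×
    IsSouslin κ T ×
    HasInjectiveAscentPath κ 𝓕fin U T
theorem4p2 em ext κ U U-down U-tree U-slim p₁₄ =
  tree , tree-down , tree-prolific , tree-slim , tree-isSouslin ,
  ascentPath , ascentPath-isAscentPath , ascentPath-isInjective
  where open Construction em ext κ U U-down U-tree U-slim p₁₄
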